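{- Let $V$ be an irreducible vector configuration with $\operatorname{Disc}(V)>0$. Let $r=\operatorname{rank}(V)$, $n=|V|$, $\delta=\deg^*(V)$ and $d=n-r-1$. Then $V$ admits a codegree$^*$ decomposition of length at least $$r+1-2\operatorname{Disc}(V)=2(d+1-2\delta)-r+1=3d+4-4\delta-n.$$
   Context: A vector configuration is a finite family $V$ of vectors in $\mathbb{R}^r$ (repetitions and copies of the zero vector allowed); subconfigurations are subfamilies, and all cardinalities count multiplicities. The rank of $V$ is $\dim\operatorname{lin}(V)$. An oriented linear hyperplane $H$ is given by a nonzero linear functional $f$, with $H^+=\{f>0\}$, $H^-=\{f<0\}$, $\overline{H}^-=\{f\le 0\}$. Define $\operatorname{codeg}^*(V)=\min_H|\overline{H}^-\cap V|$, the dual degree $\deg^*(V)=\max_H|H^+\cap V|-\operatorname{rank}(V)$, and the covector discrepancy $\operatorname{Disc}(V)=\max_H(|H^+\cap V|-|H^-\cap V|)$, all over oriented linear hyperplanes (also applied to subfamilies). $V$ is irreducible if it contains no zero vector. A codegree$^*$ decomposition of length $m$ is a partition $V=V_0\uplus V_1\uplus\dots\uplus V_m$ ($V_0$ possibly empty) with $\operatorname{codeg}^*(V_i)\ge1$ for $1\le i\le m$ and $\operatorname{codeg}^*(V)=\sum_{i=1}^m\operatorname{codeg}^*(V_i)$. -}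

module Defs where

open import Data.Nat as ℕ using (ℕ; zero; suc)
open import Data.Integer as ℤ using (ℤ; +_)
open import Data.Fin using (Fin; zero; suc)
open import Data.Bool using (Bool; true; false; _∧_; not)
open import Data.Product using (Σ; ∃; _×_; _,_)
open import Function using (_∘_)
open import Relation.Nullary using (¬_; does)
open import Relation.Binary.Core using (Rel)
open import Relation.Binary.PropositionalEquality using (_≡_)
open import Relation.Binary.Structures using (IsStrictTotalOrder)
open import Algebra.Core using (Op₁; Op₂)
open import Algebra.Structures using (IsCommutativeRing)

-- An ordered field (with propositional equality).  The real numbers are an
-- instance; the statement is formulated for an arbitrary ordered field.
record OrderedField : Set₁ where
  infixl 6 _+_
  infixl 7 _*_
  infix 4 _<_
  field
    Carrier : Set
    _+_ _*_ : Op₂ Carrier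
    -_ : Op₁ Carrier
    0# 1# : Carrier
    isCommutativeRing : IsCommutativeRing _≡_ _+_ _*_ -_ 0# 1#
    0≢1 : ¬ (0# ≡ 1#)
    _⁻¹ : (x : Carrier) → ¬ (x ≡ 0#) → Carrier
    ⁻¹-inverse : ∀ x (x≢0 : ¬ (x ≡ 0#)) → x * (_⁻¹ x x≢0) ≡ 1#
    _<_ : Rel Carrier _
    <-isStrictTotalOrder : IsStrictTotalOrder _≡_ _<_
    +-mono-< : ∀ {x y} z → x < y → x + z < y + z
    *-pos : ∀ {x y} → 0# < x → 0# < y → 0# < x * y

module Geometry (F : OrderedField) where
  open OrderedField F
  open IsStrictTotalOrder <-isStrictTotalOrder using (_<?_)

  Σ[_] : ∀ {k} → (Fin k → Carrier) → Carrier
  Σ[_] {zero} _ = 0#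
  Σ[_] {suc k} f = f zero + Σ[ f ∘ suc ]

  sumℕ : ∀ {k} → (Fin k → ℕ) → ℕ
  sumℕ {zero} _ = 0
  sumℕ {suc k} f = f zero ℕ.+ sumℕ (f ∘ suc)

  count : ∀ {k} → (Fin k → Bool) → ℕ
  count {zero} _ = 0
  count {suc k} p = (if p zero then 1 else 0) ℕ.+ count (p ∘ suc)
    where
    open import Data.Bool using (if_then_else_)

  Vector : ℕ → Set
  Vector a = Fin a → Carrier

  IsZero : ∀ {a} → Vector a → Set
  IsZero v = ∀ i → v i ≡ 0#

  Config : ℕ → ℕ → Set
  Config a n = Fin n → Vector a

  Subfamily : ℕ → Set
  Subfamily n = Fin n → Bool

  whole : ∀ {n} → Subfamily n
  whole _ = true

  _·_ : ∀ {a} → Vector a → Vector a → Carrier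
  f · v = Σ[ (λ i → f i * v i) ]

  -- oriented linear hyperplanes = nonzero linear functionals
  Functional : ℕ → Set
  Functional a = Σ (Vector a) (λ f → ¬ IsZero f)

  module _ {a n : ℕ} (V : Config a n) where
    pos? neg? : Vector a → Fin n → Bool
    pos? f j = does (0# <? (f · V j))
    neg? f j = does ((f · V j) <? 0#)

    plusCount minusCount closedMinusCount : Vector a → Subfamily n → ℕ
    plusCount f S = count (λ j → S j ∧ pos? f j)
    minusCount f S = count (λ j → S j ∧ neg? f j)
    closedMinusCount f S = count (λ j → S j ∧ not (pos? f j))

    Irreducible : Set
    Irreducible = ∀ j → ¬ IsZero (V j)

    IsCodegStar : Subfamily n → ℕ → Set
    IsCodegStar S k =
      (Σ (Functional a) λ (f , _) → closedMinusCount f S ≡ k) ×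
      (∀ ((f , _) : Functional a) → k ℕ.≤ closedMinusCount f S)

    IsMaxPlus : ℕ → Set
    IsMaxPlus p =
      (Σ (Functional a) λ (f , _) → plusCount f whole ≡ p) ×
      (∀ ((f , _) : Functional a) → plusCount f whole ℕ.≤ p)

    disc : Vector a → ℤ
    disc f = + plusCount f whole ℤ.- + minusCount f whole

    IsDisc : ℤ → Set
    IsDisc D =
      (Σ (Functional a) λ (f , _) → disc f ≡ D) ×
      (∀ ((f , _) : Functional a) → disc f ℤ.≤ D)

    LinIndep : Subfamily n → Set
    LinIndep S = ∀ (c : Fin n → Carrier) →
      (∀ j → S j ≡ false → c j ≡ 0#) →
      (∀ i → Σ[ (λ j → c j * V j i) ] ≡ 0#) →
      ∀ j → c j ≡ 0#

    IsRank : ℕ → Set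
    IsRank r =
      (Σ (Subfamily n) λ S → LinIndep S × count S ≡ r) ×
      (∀ S → LinIndep S → count S ℕ.≤ r)

    IsDegStar : ℤ → Set
    IsDegStar δ = Σ ℕ λ p → Σ ℕ λ r → IsMaxPlus p × IsRank r × δ ≡ + p ℤ.- + r

    -- codegree* decomposition of length m: a labelling lab : Fin n → Fin (1+m),
    -- V_0 = lab⁻¹(0) (possibly empty), V_i = lab⁻¹(i) for 1 ≤ i ≤ m,
    -- with codeg*(V_i) ≥ 1 and codeg*(V) = Σ_i codeg*(V_i).
    part : ∀ {m} → (Fin n → Fin (suc m)) → Fin (suc m) → Subfamily n
    part lab i j = does (lab j Data.Fin.≟ i)
      where import Data.Fin

    CodegDecomposition : ℕ → Set
    CodegDecomposition m =
      Σ (Fin n → Fin (suc m)) λ lab →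
      Σ (Fin m → ℕ) λ c →
        (∀ i → IsCodegStar (part lab (suc i)) (c i)) ×
        (∀ i → 1 ℕ.≤ c i) ×
        IsCodegStar whole (sumℕ c)

{-# OPTIONS --safe #-}

-- Delete antipodal pairs {v, -λv} from V as long as possible, k of them, leaving W.  A pair has
-- codegree* 1 and discrepancy 0, so the pairs together with W (put into V₀ when W lies in an open
-- half-space) form a codegree* decomposition, and Disc(W) = Disc(V) = D.  As rank(V) ≤ k + rank(W),
-- everything rests on rank(W) ≤ 2D for configurations W without antipodal pairs.
--
-- This bound is proved by strong induction on D.  For a flat N spanned by vectors of W the
-- discrepancies of N and of the contraction W/N add up to at most D; if both are positive, then N
-- and the uncancelled part E of W/N are spanned by at most 2D vectors altogether, so if
-- rank(W) > 2D some x ∈ W lies outside their span.  Contracting x leaves E unchanged, so by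
-- downward induction on N every proper contraction W/N is balanced.  Now order the lines of W by
-- the slope g/f of two generic functionals.  In a plane in which two lines w, c come first, balance
-- at w and at c forces their signed multiplicities to be opposite.  The first line, the first line
-- different from it, and the first line outside the plane of these two are pairwise of this kind:
-- three numbers with pairwise sums 0, all nonzero, which is absurd.
module Submission where

open import Defs
open import Data.Nat as ℕ using (ℕ; zero; suc)
open import Data.Nat.Induction using (<-rec)
import Data.Nat.Properties as ℕ
open import Data.Integer as ℤ using (ℤ; 0ℤ; 1ℤ; -1ℤ)
import Data.Integer.Properties as ℤ
open import Data.Integer.Solver using (module +-*-Solver)
open import Data.Fin using (Fin; zero; suc)
import Data.Fin.Properties as Fin
open import Data.Bool using (Bool; true; false; _∧_; _∨_; not; if_then_else_)
import Data.Bool.Properties as Bool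
open import Data.Product using (Σ; ∃; _×_; _,_; proj₁; proj₂)
open import Data.Sum using (_⊎_; inj₁; inj₂)
open import Data.Empty using (⊥; ⊥-elim)
open import Data.List using (List; []; _∷_; _++_; length; map; tabulate; cartesianProductWith; allFin)
import Data.List.Properties as List
open import Data.List.Relation.Unary.All as All using (All; []; _∷_)
import Data.List.Relation.Unary.All.Properties as All
open import Data.List.Relation.Unary.Any using (here; there)
open import Data.List.Membership.Propositional using (_∈_)
open import Data.List.Membership.Propositional.Properties using (∈-tabulate⁺; ∈-++⁺ˡ; ∈-map⁺; ∈-cartesianProductWith⁺; ∈-allFin)
open import Function using (_∘_)
open import Level using (0ℓ)
open import Relation.Nullary using (¬_; Dec; yes; no; does)
open import Relation.Nullary.Decidable using (_×-dec_; ¬?; decidable-stable; dec-true; dec-false)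
open import Relation.Binary.PropositionalEquality
open import Relation.Binary.Structures using (IsStrictTotalOrder)
open import Relation.Binary.Definitions using (tri<; tri≈; tri>)
open import Algebra.Bundles using (CommutativeRing)
import Algebra.Properties.Ring as RingProperties
import Algebra.Properties.CommutativeSemigroup as CommutativeSemigroupProperties
open import Algebra.Properties.Semiring.Sum ℤ.+-*-semiring using (sum; sum-cong-≗; ∑-distrib-+; *-distribˡ-sum; sum-replicate-zero)
open ≡-Reasoning

-- Arithmetic and signs in an ordered field.

module OrderedFieldProperties (F : OrderedField) where
  open OrderedField F
  open IsStrictTotalOrder <-isStrictTotalOrder public
    using (compare; _≟_; _<?_) renaming (irrefl to <-irrefl; asym to <-asym; trans to <-trans)

  commutativeRing : CommutativeRing 0ℓ 0ℓ
  commutativeRing = record { isCommutativeRing = isCommutativeRing }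

  open CommutativeRing commutativeRing public
    using (ring; +-commutativeSemigroup; +-assoc; +-comm; +-identityˡ; +-identityʳ; -‿inverseˡ; -‿inverseʳ
          ; *-assoc; *-comm; *-identityˡ; *-identityʳ; distribˡ; distribʳ; zeroˡ; zeroʳ)
  open RingProperties ring public
    using (-‿distribˡ-*; -‿distribʳ-*; -‿involutive; -0#≈0#)

  Nonzero : Carrier → Set
  Nonzero x = ¬ (x ≡ 0#)

  1≢0 : Nonzero 1#
  1≢0 e = 0≢1 (sym e)

  x<0⇒0<-x : ∀ {x} → x < 0# → 0# < - x
  x<0⇒0<-x {x} p = subst₂ _<_ (-‿inverseʳ x) (+-identityˡ (- x)) (+-mono-< (- x) p)

  0<-x⇒x<0 : ∀ {x} → 0# < - x → x < 0#
  0<-x⇒x<0 {x} p = subst₂ _<_ (+-identityˡ x) (-‿inverseˡ x) (+-mono-< x p)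

  +-pos : ∀ {x y} → 0# < x → 0# < y → 0# < x + y
  +-pos {x} {y} p q = <-trans q (subst (_< x + y) (+-identityˡ y) (+-mono-< y p))

  x<y⇒0<y-x : ∀ {x y} → x < y → 0# < y + - x
  x<y⇒0<y-x {x} {y} p = subst (_< y + - x) (-‿inverseʳ x) (+-mono-< (- x) p)

  a+c*0≡a : ∀ {a c z} → z ≡ 0# → a + c * z ≡ a
  a+c*0≡a {a} {c} refl = trans (cong (a +_) (zeroʳ c)) (+-identityʳ a)

  a-a*1≡0 : ∀ a {z} → z ≡ 1# → a + - a * z ≡ 0#
  a-a*1≡0 a refl = trans (cong (a +_) (*-identityʳ (- a))) (-‿inverseʳ a)

  a-b*c≡0⇒a≡b*c : ∀ {a b c} → a + - b * c ≡ 0# → a ≡ b * c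
  a-b*c≡0⇒a≡b*c {a} {b} {c} e = begin
    a                         ≡⟨ +-identityʳ a ⟨
    a + 0#                    ≡⟨ cong (a +_) (-‿inverseˡ (b * c)) ⟨
    a + (- (b * c) + b * c)   ≡⟨ +-assoc a _ _ ⟨
    a + - (b * c) + b * c     ≡⟨ cong (λ t → a + t + b * c) (-‿distribˡ-* b c) ⟩
    a + - b * c + b * c       ≡⟨ cong (_+ b * c) e ⟩
    0# + b * c                ≡⟨ +-identityˡ (b * c) ⟩
    b * c                     ∎

  -a*b≡-b*a : ∀ a b → - a * b ≡ - b * a
  -a*b≡-b*a a b = trans (sym (-‿distribˡ-* a b)) (trans (cong -_ (*-comm a b)) (-‿distribˡ-* b a))

  *-cancel : ∀ {x y} → x * y ≡ 0# → Nonzero y → x ≡ 0#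
  *-cancel {x} {y} e nz = begin
    x                  ≡⟨ *-identityʳ x ⟨
    x * 1#             ≡⟨ cong (x *_) (⁻¹-inverse y nz) ⟨
    x * (y * (y ⁻¹) nz) ≡⟨ *-assoc x y _ ⟨
    x * y * (y ⁻¹) nz  ≡⟨ cong (_* (y ⁻¹) nz) e ⟩
    0# * (y ⁻¹) nz     ≡⟨ zeroˡ _ ⟩
    0#                 ∎

  x≡xy⁻¹y : ∀ {x y} (nz : Nonzero y) → x ≡ x * (y ⁻¹) nz * y
  x≡xy⁻¹y {x} {y} nz = sym (trans (*-assoc x _ y)
    (trans (cong (x *_) (trans (*-comm _ y) (⁻¹-inverse y nz))) (*-identityʳ x)))

  0<1 : 0# < 1#
  0<1 with compare 0# 1#
  ... | tri< p _ _ = p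
  ... | tri≈ _ e _ = ⊥-elim (0≢1 e)
  ... | tri> _ _ p = subst (0# <_) (trans (sym (-‿distribˡ-* 1# _)) (trans (cong -_ (*-identityˡ _)) (-‿involutive 1#)))
                       (*-pos (x<0⇒0<-x p) (x<0⇒0<-x p))

  data HasSign (x : Carrier) : ℤ → Set where
    pos  : 0# < x → HasSign x 1ℤ
    null : x ≡ 0# → HasSign x 0ℤ
    neg  : x < 0# → HasSign x -1ℤ

  sgn : Carrier → ℤ
  sgn x with compare 0# x
  ... | tri< _ _ _ = 1ℤ
  ... | tri≈ _ _ _ = 0ℤ
  ... | tri> _ _ _ = -1ℤ

  hasSign : ∀ x → HasSign x (sgn x)
  hasSign x with compare 0# x
  ... | tri< p _ _ = pos p
  ... | tri≈ _ e _ = null (sym e)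
  ... | tri> _ _ p = neg p

  sgn-unique : ∀ {x s} → HasSign x s → sgn x ≡ s
  sgn-unique {x} h with compare 0# x | h
  ... | tri< _ _ _ | pos _ = refl
  ... | tri< p _ _ | null e = ⊥-elim (<-irrefl (sym e) p)
  ... | tri< p _ _ | neg q = ⊥-elim (<-asym p q)
  ... | tri≈ _ e _ | pos p = ⊥-elim (<-irrefl e p)
  ... | tri≈ _ _ _ | null _ = refl
  ... | tri≈ _ e _ | neg p = ⊥-elim (<-irrefl (sym e) p)
  ... | tri> _ _ p | pos q = ⊥-elim (<-asym p q)
  ... | tri> _ _ p | null e = ⊥-elim (<-irrefl e p)
  ... | tri> _ _ _ | neg _ = refl

  sgn-0 : ∀ {x} → x ≡ 0# → sgn x ≡ 0ℤ
  sgn-0 = sgn-unique ∘ null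

  sgn-pos : ∀ {x} → 0# < x → sgn x ≡ 1ℤ
  sgn-pos = sgn-unique ∘ pos

  sgn-neg : ∀ {x} → x < 0# → sgn x ≡ -1ℤ
  sgn-neg = sgn-unique ∘ neg

  sgn≡0⇒≡0 : ∀ {x} → sgn x ≡ 0ℤ → x ≡ 0#
  sgn≡0⇒≡0 {x} e with sgn x | hasSign x
  sgn≡0⇒≡0 e | _ | null z = z
  sgn≡0⇒≡0 () | _ | pos _
  sgn≡0⇒≡0 () | _ | neg _

  hasSign-*-neg : ∀ {x y s} → HasSign (x * - y) s → HasSign (x * y) (ℤ.- s)
  hasSign-*-neg {x} {y} (pos p)  = neg (0<-x⇒x<0 (subst (0# <_) (sym (-‿distribʳ-* x y)) p))
  hasSign-*-neg {x} {y} (null e) = null (trans (sym (-‿involutive _)) (trans (cong -_ (trans (-‿distribʳ-* x y) e)) -0#≈0#))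
  hasSign-*-neg {x} {y} (neg p)  = pos (subst (0# <_) (trans (cong -_ (sym (-‿distribʳ-* x y))) (-‿involutive _)) (x<0⇒0<-x p))

  sgn-*-pos : ∀ {x y} → 0# < y → HasSign (x * y) (sgn x)
  sgn-*-pos {x} {y} q with sgn x | hasSign x
  ... | _ | pos p  = pos (*-pos p q)
  ... | _ | null e = null (trans (cong (_* y) e) (zeroˡ y))
  ... | _ | neg p  = neg (0<-x⇒x<0 (subst (0# <_) (sym (-‿distribˡ-* x y)) (*-pos (x<0⇒0<-x p) q)))

  sgn-* : ∀ x y → sgn (x * y) ≡ sgn x ℤ.* sgn y
  sgn-* x y with sgn y | hasSign y
  ... | _ | pos q  = trans (sgn-unique (sgn-*-pos q)) (sym (ℤ.*-identityʳ (sgn x)))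
  ... | _ | null e = trans (sgn-unique (null (trans (cong (x *_) e) (zeroʳ x)))) (sym (ℤ.*-zeroʳ (sgn x)))
  ... | _ | neg q  = trans (sgn-unique (hasSign-*-neg (sgn-*-pos (x<0⇒0<-x q))))
                           (trans (sym (ℤ.-1*i≡-i (sgn x))) (ℤ.*-comm -1ℤ (sgn x)))

  argmin : ∀ {k} {P : Fin k → Set} → (∀ j → Dec (P j)) → (θ : Fin k → Carrier) →
    ∃ P → ∃ λ m → P m × (∀ j → P j → ¬ θ j < θ m)
  argmin {suc k} {P} P? θ ne with Fin.any? (P? ∘ suc)
  ... | no none = first ne
    where
    first : ∃ P → ∃ λ m → P m × (∀ j → P j → ¬ θ j < θ m)
    first (suc j , Pj) = ⊥-elim (none (j , Pj))
    first (zero , P0) = zero , P0 , λ { zero _ → <-irrefl refl ; (suc j) Pj → ⊥-elim (none (j , Pj)) }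
  ... | yes rest with argmin (P? ∘ suc) (θ ∘ suc) rest | P? zero
  ... | m , Pm , least | no ¬P0 = suc m , Pm , λ { zero P0 → ⊥-elim (¬P0 P0) ; (suc j) → least j }
  ... | m , Pm , least | yes P0 with θ zero <? θ (suc m)
  ... | yes lt = zero , P0 , λ { zero _ → <-irrefl refl ; (suc j) Pj lt′ → least j Pj (<-trans lt′ lt) }
  ... | no ¬lt = suc m , Pm , λ { zero _ → ¬lt ; (suc j) → least j }

-- Functionals, spans and generic perturbations.

module LinearAlgebra (F : OrderedField) where
  open OrderedField F
  open Geometry F
  open OrderedFieldProperties F public
  open CommutativeSemigroupProperties +-commutativeSemigroup using (interchange)

  Σ-linear : ∀ {k} c {t u w : Fin k → Carrier} → (∀ i → t i ≡ u i + c * w i) → Σ[ t ] ≡ Σ[ u ] + c * Σ[ w ]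
  Σ-linear {zero} c _ = sym (trans (+-identityˡ _) (zeroʳ c))
  Σ-linear {suc k} c {t} {u} {w} e = begin
    t zero + Σ[ t ∘ suc ]                                         ≡⟨ cong₂ _+_ (e zero) (Σ-linear c (e ∘ suc)) ⟩
    (u zero + c * w zero) + (Σ[ u ∘ suc ] + c * Σ[ w ∘ suc ])     ≡⟨ interchange _ _ _ _ ⟩
    (u zero + Σ[ u ∘ suc ]) + (c * w zero + c * Σ[ w ∘ suc ])     ≡⟨ cong (u zero + Σ[ u ∘ suc ] +_) (distribˡ c _ _) ⟨
    (u zero + Σ[ u ∘ suc ]) + c * (w zero + Σ[ w ∘ suc ])         ∎

  Σ-zero : ∀ {k} {t : Fin k → Carrier} → (∀ i → t i ≡ 0#) → Σ[ t ] ≡ 0#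
  Σ-zero {zero} _ = refl
  Σ-zero {suc k} e = trans (cong₂ _+_ (e zero) (Σ-zero (e ∘ suc))) (+-identityˡ 0#)

  basis : ∀ {k} → Fin k → Vector k
  basis zero zero = 1#
  basis zero (suc _) = 0#
  basis (suc i) zero = 0#
  basis (suc i) (suc j) = basis i j

  basis-· : ∀ {k} i (v : Vector k) → basis i · v ≡ v i
  basis-· zero v = trans (cong₂ _+_ (*-identityˡ _) (Σ-zero λ i → zeroˡ (v (suc i)))) (+-identityʳ _)
  basis-· (suc i) v = trans (cong₂ _+_ (zeroˡ _) (basis-· i (v ∘ suc))) (+-identityˡ _)

  module _ {a : ℕ} where
    infixl 6 _+[_]_
    _+[_]_ : Vector a → Carrier → Vector a → Vector a
    (v +[ c ] w) i = v i + c * w i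

    ·-linearˡ : ∀ f c g (v : Vector a) → (f +[ c ] g) · v ≡ f · v + c * (g · v)
    ·-linearˡ f c g v = Σ-linear c λ i → trans (distribʳ (v i) _ _) (cong (f i * v i +_) (*-assoc c _ _))

    ·-linearʳ : ∀ (f : Vector a) v c w → f · (v +[ c ] w) ≡ f · v + c * (f · w)
    ·-linearʳ f v c w = Σ-linear c λ i → trans (distribˡ (f i) _ _) (cong (f i * v i +_)
      (trans (sym (*-assoc (f i) c (w i))) (trans (cong (_* w i) (*-comm (f i) c)) (*-assoc c _ _))))

    zeroVector : Vector a
    zeroVector _ = 0#

    zeroVector-· : ∀ v → zeroVector · v ≡ 0#
    zeroVector-· v = Σ-zero λ i → zeroˡ (v i)

    ·-zero : ∀ (f v : Vector a) → IsZero v → f · v ≡ 0#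
    ·-zero f v z = Σ-zero λ i → trans (cong (f i *_) (z i)) (zeroʳ (f i))

    infix 4 _⟂_ _∈cl_
    _⟂_ : Vector a → List (Vector a) → Set
    f ⟂ zs = All (λ z → f · z ≡ 0#) zs

    -- The linear span, described through its annihilator.
    _∈cl_ : Vector a → List (Vector a) → Set
    x ∈cl zs = ∀ f → f ⟂ zs → f · x ≡ 0#

    Separates : List (Vector a) → Vector a → Vector a → Set
    Separates zs x f = f ⟂ zs × f · x ≡ 1#

    ⟂-combine : ∀ {f g c} zs → f ⟂ zs → g ⟂ zs → f +[ c ] g ⟂ zs
    ⟂-combine [] [] [] = []
    ⟂-combine (z ∷ zs) (p ∷ ps) (q ∷ qs) =
      trans (·-linearˡ _ _ _ z) (trans (a+c*0≡a q) p) ∷ ⟂-combine zs ps qs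

    zeroVector-⟂ : ∀ zs → zeroVector ⟂ zs
    zeroVector-⟂ [] = []
    zeroVector-⟂ (z ∷ zs) = zeroVector-· z ∷ zeroVector-⟂ zs

    -- When `f · x` is 1, this projects `h` along `f` onto the functionals that vanish on `x`; on
    -- the kernel of `f` the values of `h` are kept.
    eliminate : Vector a → Vector a → Vector a → Vector a
    eliminate f x h = h +[ - (h · x) ] f

    eliminate-· : ∀ {f x} h → f · x ≡ 1# → eliminate f x h · x ≡ 0#
    eliminate-· {f} {x} h e = trans (·-linearˡ h _ f x) (a-a*1≡0 (h · x) e)

    eliminate-kernel : ∀ {f x y} h → f · y ≡ 0# → eliminate f x h · y ≡ h · y
    eliminate-kernel {f} {x} {y} h e = trans (·-linearˡ h _ f y) (a+c*0≡a e)

    eliminate-⟂ : ∀ {zs f x h} → Separates zs x f → h ⟂ zs → eliminate f x h ⟂ (x ∷ zs)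
    eliminate-⟂ {zs} {h = h} (f⟂ , fx) h⟂ = eliminate-· h fx ∷ ⟂-combine zs h⟂ f⟂

    scale-to-1 : ∀ {zs f x} → f ⟂ zs → Nonzero (f · x) → ∃ (Separates zs x)
    scale-to-1 {zs} {f} {x} f⟂ nz = zeroVector +[ c ] f , ⟂-combine zs (zeroVector-⟂ zs) f⟂ ,
      trans (·-linearˡ zeroVector c f x) (trans (cong₂ _+_ (zeroVector-· x) (trans (*-comm c _) (⁻¹-inverse _ nz))) (+-identityˡ 1#))
      where c = ((f · x) ⁻¹) nz

    -- Gaussian elimination on the generators. It makes span membership decidable and turns
    -- non-membership into an explicit functional.
    separate : ∀ zs x → x ∈cl zs ⊎ ∃ (Separates zs x)
    separate [] x with zeros? x
      where
      zeros? : ∀ {k} (v : Vector k) → IsZero v ⊎ ∃ λ i → Nonzero (v i)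
      zeros? {zero} v = inj₁ λ ()
      zeros? {suc k} v with v zero ≟ 0# | zeros? (v ∘ suc)
      ... | no nz | _ = inj₂ (zero , nz)
      ... | yes _ | inj₂ (i , nz) = inj₂ (suc i , nz)
      ... | yes z | inj₁ zs = inj₁ λ { zero → z ; (suc i) → zs i }
    ... | inj₁ z = inj₁ λ f _ → ·-zero f x z
    ... | inj₂ (i , nz) = inj₂ (scale-to-1 [] λ e → nz (trans (sym (basis-· i x)) e))
    separate (z ∷ zs) x with separate zs x
    ... | inj₁ x∈ = inj₁ λ { f (_ ∷ f⟂) → x∈ f f⟂ }
    ... | inj₂ (f , f⟂ , fx) with f · z ≟ 0#
    ... | yes fz = inj₂ (f , fz ∷ f⟂ , fx)
    ... | no nz with scale-to-1 f⟂ nz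
    -- Here `z` lies outside the span of `zs`, so `x` is moved along `z` into the kernel of `f′`. A
    -- functional that vanishes on `z` does not see the move, and `eliminate f′ z g` takes on `x`
    -- the value that `g` takes on the moved vector.
    ... | f′ , f′⟂ , f′z with separate zs (x +[ - (f′ · x) ] z)
    ... | inj₁ x∈ = inj₁ λ { g (gz ∷ g⟂) →
            trans (sym (trans (·-linearʳ g x _ z) (a+c*0≡a gz))) (x∈ g g⟂) }
    ... | inj₂ (g , g⟂ , gx′) = inj₂ (eliminate f′ z g , eliminate-⟂ (f′⟂ , f′z) g⟂ , (begin
            eliminate f′ z g · x              ≡⟨ ·-linearˡ g _ f′ x ⟩
            g · x + - (g · z) * (f′ · x)      ≡⟨ cong (g · x +_) (-a*b≡-b*a (g · z) (f′ · x)) ⟩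
            g · x + - (f′ · x) * (g · z)      ≡⟨ ·-linearʳ g x _ z ⟨
            g · (x +[ - (f′ · x) ] z)         ≡⟨ gx′ ⟩
            1#                                ∎))

    _∈cl?_ : ∀ x zs → Dec (x ∈cl zs)
    x ∈cl? zs with separate zs x
    ... | inj₁ x∈ = yes x∈
    ... | inj₂ (f , f⟂ , fx) = no λ x∈ → 1≢0 (trans (sym fx) (x∈ f f⟂))

    ∉cl⇒separates : ∀ {zs x} → ¬ x ∈cl zs → ∃ (Separates zs x)
    ∉cl⇒separates {zs} {x} x∉ with separate zs x
    ... | inj₁ x∈ = ⊥-elim (x∉ x∈)
    ... | inj₂ s = s

    ∈cl-head : ∀ {x zs} → x ∈cl (x ∷ zs)
    ∈cl-head f (fx ∷ _) = fx

    ∈cl-there : ∀ {x y zs} → x ∈cl zs → x ∈cl (y ∷ zs)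
    ∈cl-there x∈ f (_ ∷ f⟂) = x∈ f f⟂

    ∈cl-swap : ∀ {x y z zs} → x ∈cl (y ∷ z ∷ zs) → x ∈cl (z ∷ y ∷ zs)
    ∈cl-swap x∈ f (fz ∷ fy ∷ f⟂) = x∈ f (fy ∷ fz ∷ f⟂)

    -- If f vanishes on y and on M but not on x, then x plays no role in placing y in the span.
    ∈cl-drop : ∀ {M x y f} → Separates M x f → f · y ≡ 0# → y ∈cl (x ∷ M) → y ∈cl M
    ∈cl-drop {x = x} {f = f} s fy y∈ h h⟂ =
      trans (sym (eliminate-kernel {f} {x} h fy)) (y∈ (eliminate f x h) (eliminate-⟂ s h⟂))

    -- Modulo `zs` the vector `y` is the multiple `f · y` of `x`: `eliminate f x h` vanishes on `x`
    -- and `zs`, hence on `y`.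
    on-line : ∀ {zs x y f h} → Separates zs x f → h ⟂ zs → y ∈cl (x ∷ zs) → h · y ≡ (h · x) * (f · y)
    on-line {x = x} {y} {f} {h} s h⟂ y∈ = a-b*c≡0⇒a≡b*c
      (trans (sym (·-linearˡ h _ f y)) (y∈ (eliminate f x h) (eliminate-⟂ s h⟂)))

    -- By `on-line`, `h · y` is `h · x` times the coordinate of `y`. That coordinate is nonzero,
    -- since otherwise `y` would already lie in the span of `zs`.
    exchange : ∀ {zs x y} → y ∈cl (x ∷ zs) → ¬ y ∈cl zs → x ∈cl (y ∷ zs)
    exchange {zs} {x} {y} y∈ y∉ with x ∈cl? zs
    ... | yes x∈ = ∈cl-there x∈
    ... | no x∉ with ∉cl⇒separates x∉
    ... | f , s@(f⟂ , fx) = λ { h (hy ∷ h⟂) → *-cancel (trans (sym (on-line s h⟂ y∈)) hy)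
                                    λ fy → y∉ λ g g⟂ → trans (on-line s g⟂ y∈) (trans (cong (g · x *_) fy) (zeroʳ _)) }

    private
      -- N dominates every quotient -(f · u) / (g · u)
      bound : ∀ (f g : Vector a) us → ∃ λ N → 0# < N ×
        (∀ {u} → u ∈ us → Nonzero (g · u) → ∃ λ q → f · u ≡ q * (g · u) × 0# < q + N)
      bound f g [] = 1# , 0<1 , λ ()
      bound f g (u ∷ us) with bound f g us | g · u ≟ 0#
      ... | N , 0<N , ok | yes gu = N , 0<N , λ { (here refl) nz → ⊥-elim (nz gu) ; (there u∈) → ok u∈ }
      ... | N , 0<N , ok | no nz with 0# <? (- ((f · u) * ((g · u) ⁻¹) nz))
      ... | yes 0<-q = N + - q , +-pos 0<N 0<-q , λ
            { (here refl) _ → q , x≡xy⁻¹y nz , subst (0# <_) (sym (trans (+-comm q _)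
                (trans (+-assoc N _ _) (trans (cong (N +_) (-‿inverseˡ q)) (+-identityʳ N))))) 0<N
            ; (there u∈) nz′ → let q′ , e , p = ok u∈ nz′ in
                q′ , e , subst (0# <_) (+-assoc q′ N _) (+-pos p 0<-q) }
            where q = (f · u) * ((g · u) ⁻¹) nz
      ... | no ¬0<-q = N , 0<N , λ
            { (here refl) _ → q , x≡xy⁻¹y nz , 0≤x+pos 0<N
            ; (there u∈) → ok u∈ }
            where
            q = (f · u) * ((g · u) ⁻¹) nz
            0≤x+pos : ∀ {y} → 0# < y → 0# < q + y
            0≤x+pos {y} 0<y with compare 0# q
            ... | tri< 0<q _ _ = +-pos 0<q 0<y
            ... | tri≈ _ e _ = subst (0# <_) (trans (sym (+-identityˡ y)) (cong (_+ y) e)) 0<y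
            ... | tri> _ _ q<0 = ⊥-elim (¬0<-q (x<0⇒0<-x q<0))

    -- The signs of `g` plus an infinitesimal multiple of `f`: `g` decides, and `f` breaks the ties.
    -- It is realised as `f` plus a large multiple of `g`.
    record Perturbation (g f : Vector a) (us : List (Vector a)) : Set where
      field
        perturbed : Vector a
        preserves-⟂ : ∀ {zs} → g ⟂ zs → f ⟂ zs → perturbed ⟂ zs
        dominant : ∀ {u} → u ∈ us → Nonzero (g · u) → sgn (perturbed · u) ≡ sgn (g · u)
        recessive : ∀ {u} → g · u ≡ 0# → sgn (perturbed · u) ≡ sgn (f · u)

      nonzero : ∀ {u} → u ∈ us → Nonzero (g · u) ⊎ Nonzero (f · u) → Nonzero (perturbed · u)
      nonzero {u} u∈ nz e with g · u ≟ 0# | nz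
      ... | no gu≢0 | _ = gu≢0 (sgn≡0⇒≡0 (trans (sym (dominant u∈ gu≢0)) (sgn-0 e)))
      ... | yes gu≡0 | inj₁ gu≢0 = gu≢0 gu≡0
      ... | yes gu≡0 | inj₂ fu≢0 = fu≢0 (sgn≡0⇒≡0 (trans (sym (recessive gu≡0)) (sgn-0 e)))

    perturb : ∀ g f us → Perturbation g f us
    perturb g f us with bound f g us
    ... | N , _ , ok = record
      { perturbed = f +[ N ] g
      ; preserves-⟂ = λ g⟂ f⟂ → ⟂-combine _ f⟂ g⟂
      ; dominant = dominant
      ; recessive = λ {u} gu → cong sgn (trans (·-linearˡ f N g u) (a+c*0≡a gu))
      }
      where
      dominant : ∀ {u} → u ∈ us → Nonzero (g · u) → sgn ((f +[ N ] g) · u) ≡ sgn (g · u)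
      dominant {u} u∈ nz with ok u∈ nz
      ... | q , e , 0<q+N = trans (cong sgn (begin
          (f +[ N ] g) · u            ≡⟨ ·-linearˡ f N g u ⟩
          f · u + N * (g · u)         ≡⟨ cong (_+ N * (g · u)) e ⟩
          q * (g · u) + N * (g · u)   ≡⟨ distribʳ (g · u) q N ⟨
          (q + N) * (g · u)           ≡⟨ *-comm _ (g · u) ⟩
          (g · u) * (q + N)           ∎)) (sgn-unique (sgn-*-pos 0<q+N))

    -- Each new vector outside the span is handled by perturbing with a functional that separates
    -- it; dominance keeps the earlier values nonzero.
    generic : ∀ zs us → ∃ λ g → g ⟂ zs × (∀ {u} → u ∈ us → ¬ u ∈cl zs → Nonzero (g · u))
    generic zs [] = zeroVector , zeroVector-⟂ zs , λ ()
    generic zs (u ∷ us) with generic zs us | separate zs u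
    ... | g , g⟂ , ok | inj₁ u∈cl = g , g⟂ , λ { (here refl) u∉cl → ⊥-elim (u∉cl u∈cl) ; (there u∈) → ok u∈ }
    ... | g , g⟂ , ok | inj₂ (f , f⟂ , fu) = perturbed , preserves-⟂ g⟂ f⟂ , λ
        { (here refl) _ → nonzero (here refl) (inj₂ λ e → 1≢0 (trans (sym fu) e))
        ; (there u∈) u∉cl → nonzero (there u∈) (inj₁ (ok u∈ u∉cl)) }
      where open Perturbation (perturb g f (u ∷ us))

-- Truth values, integer sums and counting.

⇔⇒≡ : ∀ {b c : Bool} → (b ≡ true → c ≡ true) → (c ≡ true → b ≡ true) → b ≡ c
⇔⇒≡ {false} {false} _ _ = refl
⇔⇒≡ {false} {true} _ p = p refl
⇔⇒≡ {true} p _ = sym (p refl)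

does⁻ : ∀ {P : Set} (d : Dec P) → does d ≡ true → P
does⁻ (yes p) _ = p

∧⁻ˡ : ∀ {b c} → b ∧ c ≡ true → b ≡ true
∧⁻ˡ {true} _ = refl

∧⁻ʳ : ∀ {b c} → b ∧ c ≡ true → c ≡ true
∧⁻ʳ {true} e = e

sum-+ : ∀ {n} {t u w : Fin n → ℤ} → (∀ j → t j ≡ u j ℤ.+ w j) → sum t ≡ sum u ℤ.+ sum w
sum-+ {u = u} {w} e = trans (sum-cong-≗ e) (∑-distrib-+ u w)

sum-zero : ∀ {n} {t : Fin n → ℤ} → (∀ j → t j ≡ 0ℤ) → sum t ≡ 0ℤ
sum-zero {n} e = trans (sum-cong-≗ e) (sum-replicate-zero n)

x+y≡z+z⇒z≤x⊎z≤y : ∀ {x y z} → x ℤ.+ y ≡ z ℤ.+ z → z ℤ.≤ x ⊎ z ℤ.≤ y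
x+y≡z+z⇒z≤x⊎z≤y {x} {y} {z} e with z ℤ.≤? x | z ℤ.≤? y
... | yes p | _ = inj₁ p
... | no _ | yes p = inj₂ p
... | no p | no q = ⊥-elim (ℤ.<-irrefl e (ℤ.+-mono-< (ℤ.≰⇒> p) (ℤ.≰⇒> q)))

-- The upper bound is lowered until it is attained. Attainment over an arbitrary type cannot be
-- decided, hence the double negation; it is removed later, where the goals are decidable.
¬¬-max : ∀ {A : Set} (val : A → ℤ) a₀ → 0ℤ ℤ.≤ val a₀ → ∀ k → (∀ a → val a ℤ.≤ ℤ.+ k) →
  ¬ ¬ (∃ λ d → (∃ λ a → ℤ.+ d ℤ.≤ val a) × (∀ a → val a ℤ.≤ ℤ.+ d))
¬¬-max val a₀ p zero ub none = none (0 , (a₀ , p) , ub)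
¬¬-max val a₀ p (suc k) ub none = ¬¬-max val a₀ p k smaller none
  where
  smaller : ∀ a → val a ℤ.≤ ℤ.+ k
  smaller a with val a ℤ.≤? ℤ.+ k
  ... | yes q = q
  ... | no q = ⊥-elim (none (suc k , (a , ℤ.i<j⇒suc[i]≤j (ℤ.≰⇒> q)) , ub))

module Counting (F : OrderedField) where
  open Geometry F

  count-< : ∀ {k} {p q : Fin k → Bool} → (∀ j → p j ≡ true → q j ≡ true) →
    ∀ j → q j ≡ true → p j ≡ false → count p ℕ.< count q
  count-≤ : ∀ {k} {p q : Fin k → Bool} → (∀ j → p j ≡ true → q j ≡ true) → count p ℕ.≤ count q
  count-≤ {zero} _ = ℕ.z≤n
  count-≤ {suc k} {p} {q} p⊆q with p zero | q zero | p⊆q zero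
  ... | false | false | _ = count-≤ (p⊆q ∘ suc)
  ... | false | true | _ = ℕ.m≤n⇒m≤1+n (count-≤ (p⊆q ∘ suc))
  ... | true | true | _ = ℕ.s≤s (count-≤ (p⊆q ∘ suc))
  ... | true | false | r with () ← r refl
  count-< {suc k} {p} {q} p⊆q zero qj pj rewrite qj | pj = ℕ.s≤s (count-≤ (p⊆q ∘ suc))
  count-< {suc k} {p} {q} p⊆q (suc j) qj pj with p zero | q zero | p⊆q zero
  ... | false | false | _ = count-< (p⊆q ∘ suc) j qj pj
  ... | false | true | _ = ℕ.m≤n⇒m≤1+n (count-< (p⊆q ∘ suc) j qj pj)
  ... | true | true | _ = ℕ.s≤s (count-< (p⊆q ∘ suc) j qj pj)
  ... | true | false | r with () ← r refl

-- Discrepancy of subfamilies, flats and contractions.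

module Configurations (F : OrderedField) {a n : ℕ} (V : Geometry.Config F a n) where
  open OrderedField F
  open Geometry F
  open LinearAlgebra F public
  open Counting F public

  -- Summing over all indices, with zero outside the subfamily, lets identities between different
  -- subfamilies be checked term by term.
  restrict : Subfamily n → (Fin n → ℤ) → Fin n → ℤ
  restrict S t j = if S j then t j else 0ℤ

  Σ⟨_⟩ : Subfamily n → (Fin n → ℤ) → ℤ
  Σ⟨ S ⟩ t = sum (restrict S t)

  if-true : ∀ {b} {x : ℤ} → b ≡ true → (if b then x else 0ℤ) ≡ x
  if-true refl = refl

  if-false : ∀ {b} {x : ℤ} → b ≡ false → (if b then x else 0ℤ) ≡ 0ℤ
  if-false refl = refl

  Σ⟨⟩-cong : ∀ {S S′} {t t′ : Fin n → ℤ} → (∀ j → S j ≡ S′ j) → (∀ j → S j ≡ true → t j ≡ t′ j) → Σ⟨ S ⟩ t ≡ Σ⟨ S′ ⟩ t′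
  Σ⟨⟩-cong {S} {S′} {t} {t′} eS et = sum-cong-≗ term
    where
    term : ∀ j → restrict S t j ≡ restrict S′ t′ j
    term j rewrite sym (eS j) with S j | et j
    ... | true | e = e refl
    ... | false | _ = refl

  σ : Vector a → Fin n → ℤ
  σ f j = sgn (f · V j)

  dsc : Subfamily n → Vector a → ℤ
  dsc S f = Σ⟨ S ⟩ (σ f)

  dsc-cong : ∀ {S S′ f f′} → (∀ j → S j ≡ S′ j) → (∀ j → S j ≡ true → f · V j ≡ f′ · V j) → dsc S f ≡ dsc S′ f′
  dsc-cong eS et = Σ⟨⟩-cong eS λ j Sj → cong sgn (et j Sj)

  dsc-scale : ∀ {S f h} c → (∀ j → S j ≡ true → h · V j ≡ c * (f · V j)) → dsc S h ≡ sgn c ℤ.* dsc S f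
  dsc-scale {S} {f} {h} c e = trans (sum-cong-≗ term) (sym (*-distribˡ-sum (sgn c) (restrict S (σ f))))
    where
    term : ∀ j → restrict S (σ h) j ≡ sgn c ℤ.* restrict S (σ f) j
    term j with S j | e j
    ... | true | ej = trans (cong sgn (ej refl)) (sgn-* c _)
    ... | false | _ = sym (ℤ.*-zeroʳ (sgn c))

  opposite : Vector a → Vector a
  opposite f = zeroVector +[ - 1# ] f

  opposite-· : ∀ f v → opposite f · v ≡ - 1# * (f · v)
  opposite-· f v = trans (·-linearˡ zeroVector _ f v) (trans (cong (_+ - 1# * (f · v)) (zeroVector-· v)) (+-identityˡ _))

  opposite-⟂ : ∀ {f zs} → f ⟂ zs → opposite f ⟂ zs
  opposite-⟂ f⟂ = ⟂-combine _ (zeroVector-⟂ _) f⟂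

  sgn-opposite : ∀ f v → sgn (opposite f · v) ≡ ℤ.- sgn (f · v)
  sgn-opposite f v = trans (cong sgn (opposite-· f v)) (trans (sgn-* (- 1#) _)
    (trans (cong (ℤ._* sgn (f · v)) (sgn-neg (0<-x⇒x<0 (subst (0# <_) (sym (-‿involutive 1#)) 0<1)))) (ℤ.-1*i≡-i _)))

  dsc-opposite : ∀ S f → dsc S (opposite f) ≡ ℤ.- dsc S f
  dsc-opposite S f = trans (dsc-scale {S} (- 1#) λ j _ → opposite-· f (V j))
    (trans (cong (ℤ._* dsc S f) (sgn-neg (0<-x⇒x<0 (subst (0# <_) (sym (-‿involutive 1#)) 0<1)))) (ℤ.-1*i≡-i _))

  infixl 6 _∩cl_ _∖cl_
  _∩cl_ _∖cl_ : Subfamily n → List (Vector a) → Subfamily n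
  (S ∩cl M) j = S j ∧ does (V j ∈cl? M)
  (S ∖cl M) j = S j ∧ not (does (V j ∈cl? M))

  ∩cl⁺ : ∀ {S M j} → S j ≡ true → V j ∈cl M → (S ∩cl M) j ≡ true
  ∩cl⁺ {S} {M} {j} Sj j∈ rewrite Sj = dec-true (V j ∈cl? M) j∈

  ∩cl⁻ˡ : ∀ {S M j} → (S ∩cl M) j ≡ true → S j ≡ true
  ∩cl⁻ˡ = ∧⁻ˡ

  ∩cl⁻ʳ : ∀ {S M j} → (S ∩cl M) j ≡ true → V j ∈cl M
  ∩cl⁻ʳ {S} {M} {j} e = does⁻ (V j ∈cl? M) (∧⁻ʳ {S j} e)

  ∩cl-false : ∀ {S M j} → ¬ V j ∈cl M → (S ∩cl M) j ≡ false
  ∩cl-false {S} {M} {j} j∉ rewrite dec-false (V j ∈cl? M) j∉ = Bool.∧-zeroʳ (S j)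

  ∖cl⁺ : ∀ {S M j} → S j ≡ true → ¬ V j ∈cl M → (S ∖cl M) j ≡ true
  ∖cl⁺ {S} {M} {j} Sj j∉ rewrite Sj = cong not (dec-false (V j ∈cl? M) j∉)

  ∖cl-false : ∀ {S M j} → V j ∈cl M → (S ∖cl M) j ≡ false
  ∖cl-false {S} {M} {j} j∈ rewrite dec-true (V j ∈cl? M) j∈ = Bool.∧-zeroʳ (S j)

  ∖cl⁻ : ∀ {S M j} → (S ∖cl M) j ≡ true → ¬ V j ∈cl M
  ∖cl⁻ {S} {M} {j} e j∈ with () ← trans (sym e) (∖cl-false {S} {M} {j} j∈)

  ∩cl-cong : ∀ {S S′ M M′} → (∀ j → V j ∈cl M → S j ≡ true → S′ j ≡ true × V j ∈cl M′) →
    (∀ j → V j ∈cl M′ → S′ j ≡ true → S j ≡ true × V j ∈cl M) → ∀ j → (S ∩cl M) j ≡ (S′ ∩cl M′) j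
  ∩cl-cong {S} {S′} {M} {M′} p q j = ⇔⇒≡
    (λ e → let (s , c) = p j (∩cl⁻ʳ {S} {M} e) (∩cl⁻ˡ {S} {M} e) in ∩cl⁺ {S′} {M′} s c)
    (λ e → let (s , c) = q j (∩cl⁻ʳ {S′} {M′} e) (∩cl⁻ˡ {S′} {M′} e) in ∩cl⁺ {S} {M} s c)

  -- The functionals that vanish on `zs` are those of the contraction by `zs`; members of `S` in the
  -- span of `zs` become zero vectors there and contribute sign 0. So this says that the contraction
  -- has discrepancy 0 everywhere.
  Balanced : List (Vector a) → Subfamily n → Set
  Balanced zs S = ∀ f → f ⟂ zs → dsc S f ≡ 0ℤ

  -- No line of the contraction by zs has as many vectors of S on one side of zero as on the other.
  Reduced : List (Vector a) → Subfamily n → Set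
  Reduced zs S = ∀ x → S x ≡ true → ¬ Balanced zs (S ∩cl (V x ∷ zs))

  -- The discrepancy is odd in the functional, so the bound at `opposite f` is the reverse
  -- inequality at `f`.
  nonpositive⇒balanced : ∀ {zs S} → (∀ f → f ⟂ zs → dsc S f ℤ.≤ 0ℤ) → Balanced zs S
  nonpositive⇒balanced {zs} {S} ub f f⟂ = ℤ.≤-antisym (ub f f⟂)
    (ℤ.neg-cancel-≤ (subst (ℤ._≤ 0ℤ) (dsc-opposite S f) (ub (opposite f) (opposite-⟂ f⟂))))

  balanced-cong : ∀ {zs S S′} → (∀ j → S j ≡ S′ j) → Balanced zs S → Balanced zs S′
  balanced-cong {zs} {S} {S′} e b f f⟂ = trans (sym (dsc-cong {S} {S′} {f} e λ _ _ → refl)) (b f f⟂)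

  GenericOn : List (Vector a) → Vector a → Set
  GenericOn M g = g ⟂ M × (∀ j → ¬ V j ∈cl M → Nonzero (g · V j))

  vectors : List (Vector a)
  vectors = tabulate V

  V∈vectors : ∀ j → V j ∈ vectors
  V∈vectors j = ∈-tabulate⁺ j

  genericOn : ∀ M → ∃ (GenericOn M)
  genericOn M with generic M vectors
  ... | g , g⟂ , ok = g , g⟂ , λ j → ok (V∈vectors j)

  -- Outside the flat `M` the functional `g` is nonzero and decides the sign; on the flat it
  -- vanishes and leaves the sign to `f`.
  dsc-perturbed : ∀ {M g f} S → GenericOn M g → (P : Perturbation g f vectors) →
    dsc S (Perturbation.perturbed P) ≡ dsc S g ℤ.+ dsc (S ∩cl M) f
  dsc-perturbed {M} {g} {f} S (g⟂ , g≢0) P = sum-+ term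
    where
    open Perturbation P
    term : ∀ j → restrict S (σ perturbed) j ≡
                 restrict S (σ g) j ℤ.+ restrict (S ∩cl M) (σ f) j
    term j with S j | V j ∈cl? M
    ... | false | _ = refl
    ... | true | yes j∈ = trans (recessive (j∈ g g⟂)) (sym (trans (cong (ℤ._+ σ f j) (sgn-0 (j∈ g g⟂))) (ℤ.+-identityˡ _)))
    ... | true | no j∉ = trans (dominant (V∈vectors j) (g≢0 j j∉)) (sym (ℤ.+-identityʳ _))

  -- Perturbing by `k` and by its opposite gives two discrepancies whose sum is twice that of `g`,
  -- because the vectors on which `g` vanishes receive opposite signs. One of the two is therefore
  -- at least as large as that of `g`.
  generic-perturbation : ∀ {M g} → g ⟂ M → ∀ S → ∃ λ h → GenericOn M h ×
    (∀ j → Nonzero (g · V j) → σ h j ≡ σ g j) × dsc S g ℤ.≤ dsc S h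
  generic-perturbation {M} {g} g⟂ S with genericOn M
  ... | k , k⟂ , k≢0 = choose (x+y≡z+z⇒z≤x⊎z≤y sums)
    where
    module P = Perturbation (perturb g k vectors)
    module Q = Perturbation (perturb g (opposite k) vectors)
    term : ∀ j → restrict S (σ P.perturbed) j ℤ.+ restrict S (σ Q.perturbed) j ≡
                 restrict S (σ g) j ℤ.+ restrict S (σ g) j
    term j with S j | g · V j ≟ 0#
    ... | false | _ = refl
    ... | true | no nz = cong₂ ℤ._+_ (P.dominant (V∈vectors j) nz) (Q.dominant (V∈vectors j) nz)
    ... | true | yes gj = begin
        σ P.perturbed j ℤ.+ σ Q.perturbed j
          ≡⟨ cong₂ ℤ._+_ (P.recessive gj) (trans (Q.recessive gj) (sgn-opposite k (V j))) ⟩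
        σ k j ℤ.+ ℤ.- σ k j                   ≡⟨ ℤ.+-inverseʳ (σ k j) ⟩
        0ℤ                                    ≡⟨ cong₂ ℤ._+_ (sgn-0 gj) (sgn-0 gj) ⟨
        σ g j ℤ.+ σ g j                       ∎
    sums : dsc S P.perturbed ℤ.+ dsc S Q.perturbed ≡ dsc S g ℤ.+ dsc S g
    sums = trans (sym (∑-distrib-+ (restrict S (σ P.perturbed)) (restrict S (σ Q.perturbed))))
             (trans (sum-cong-≗ term) (∑-distrib-+ (restrict S (σ g)) (restrict S (σ g))))
    opp≢0 : ∀ {v} → Nonzero (k · v) → Nonzero (opposite k · v)
    opp≢0 {v} nz e = nz (sgn≡0⇒≡0 (ℤ.neg-injective (trans (sym (sgn-opposite k v)) (sgn-0 e))))
    choose : dsc S g ℤ.≤ dsc S P.perturbed ⊎ dsc S g ℤ.≤ dsc S Q.perturbed → _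
    choose (inj₁ le) = P.perturbed , (P.preserves-⟂ g⟂ k⟂ , λ j j∉ → P.nonzero (V∈vectors j) (inj₂ (k≢0 j j∉))) ,
      (λ j → P.dominant (V∈vectors j)) , le
    choose (inj₂ le) = Q.perturbed , (Q.preserves-⟂ g⟂ (opposite-⟂ k⟂) , λ j j∉ → Q.nonzero (V∈vectors j) (inj₂ (opp≢0 (k≢0 j j∉)))) ,
      (λ j → Q.dominant (V∈vectors j)) , le

  -- Take `g` generic among the functionals vanishing on `V x` and `zs`. Both `g` and its
  -- perturbation by `f` have discrepancy 0 on `S`, and they differ by the discrepancy of `f` on the
  -- flat.
  balanced-line : ∀ {zs S} x → Balanced zs S → Balanced zs (S ∩cl (V x ∷ zs))
  balanced-line {zs} {S} x bal f f⟂ with genericOn (V x ∷ zs)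
  ... | g , gen@(_ ∷ g⟂ , _) = (begin
      dsc (S ∩cl (V x ∷ zs)) f              ≡⟨ ℤ.+-identityˡ _ ⟨
      0ℤ ℤ.+ dsc (S ∩cl (V x ∷ zs)) f       ≡⟨ cong (ℤ._+ dsc (S ∩cl (V x ∷ zs)) f) (bal g g⟂) ⟨
      dsc S g ℤ.+ dsc (S ∩cl (V x ∷ zs)) f  ≡⟨ dsc-perturbed {V x ∷ zs} {g} {f} S gen P ⟨
      dsc S perturbed                       ≡⟨ bal perturbed (preserves-⟂ g⟂ f⟂) ⟩
      0ℤ                                    ∎)
    where
    P = perturb g f vectors
    open Perturbation P

  -- Make `g` generic without lowering its discrepancy, then let `f` break the ties on the flat.
  dsc-flat+contraction : ∀ {zs ns S f g} → f ⟂ zs → g ⟂ (ns ++ zs) →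
    ∃ λ h → h ⟂ zs × dsc (S ∩cl (ns ++ zs)) f ℤ.+ dsc S g ℤ.≤ dsc S h
  dsc-flat+contraction {zs} {ns} {S} {f} {g} f⟂ g⟂ with generic-perturbation g⟂ S
  ... | g′ , gen@(g′⟂ , _) , _ , le = perturbed , preserves-⟂ (All.++⁻ʳ ns g′⟂) f⟂ ,
    ℤ.≤-trans (ℤ.+-monoʳ-≤ (dsc (S ∩cl (ns ++ zs)) f) le)
      (ℤ.≤-reflexive (trans (ℤ.+-comm (dsc (S ∩cl (ns ++ zs)) f) (dsc S g′)) (sym (dsc-perturbed {ns ++ zs} {g′} {f} S gen P))))
    where
    P = perturb g′ f vectors
    open Perturbation P

  -- On a line of the contraction every functional is a multiple of `f`, so a single test functional
  -- suffices. This makes balance of a line decidable.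
  line-balanced : ∀ {zs S x f} → Separates zs (V x) f → dsc (S ∩cl (V x ∷ zs)) f ≡ 0ℤ → Balanced zs (S ∩cl (V x ∷ zs))
  line-balanced {zs} {S} {x} {f} s e h h⟂ =
    trans (dsc-scale {S ∩cl (V x ∷ zs)} {f} {h} (h · V x) λ j j∈ → on-line s h⟂ (∩cl⁻ʳ {S} j∈))
          (trans (cong (sgn (h · V x) ℤ.*_) e) (ℤ.*-zeroʳ (sgn (h · V x))))

  dsc-vanishing : ∀ {S f} → (∀ j → S j ≡ true → f · V j ≡ 0#) → dsc S f ≡ 0ℤ
  dsc-vanishing {S} {f} vanishes = sum-zero term
    where
    term : ∀ j → restrict S (σ f) j ≡ 0ℤ
    term j with S j | vanishes j
    ... | true | e = sgn-0 (e refl)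
    ... | false | _ = refl

  dsc-zeroVector : ∀ S → dsc S zeroVector ≡ 0ℤ
  dsc-zeroVector S = dsc-vanishing {S} λ j _ → zeroVector-· (V j)

  ∈cl-absorb : ∀ {zs} {x y : Vector a} → x ∈cl zs → y ∈cl (x ∷ zs) → y ∈cl zs
  ∈cl-absorb x∈ y∈ f f⟂ = y∈ f (x∈ f f⟂ ∷ f⟂)

  loop-balanced : ∀ {zs S x} → V x ∈cl zs → Balanced zs (S ∩cl (V x ∷ zs))
  loop-balanced {zs} {S} {x} x∈ f f⟂ = dsc-vanishing {S ∩cl (V x ∷ zs)} λ j j∈ → ∈cl-absorb {zs} x∈ (∩cl⁻ʳ {S} j∈) f f⟂

  line-balanced? : ∀ zs S x → Dec (Balanced zs (S ∩cl (V x ∷ zs)))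
  line-balanced? zs S x with separate zs (V x)
  ... | inj₁ x∈ = yes (loop-balanced {zs} {S} {x} x∈)
  ... | inj₂ (f , s@(f⟂ , _)) with dsc (S ∩cl (V x ∷ zs)) f ℤ.≟ 0ℤ
  ... | yes e = yes (line-balanced {zs} {S} s e)
  ... | no ¬e = no λ bal → ¬e (bal f f⟂)

  -- Deleting balanced lines one by one does not change the discrepancy of any hyperplane through zs.
  reduce : ∀ zs S → ∃ λ E → Reduced zs E × (∀ f → f ⟂ zs → dsc E f ≡ dsc S f)
  reduce zs S = go (suc (count S)) S ℕ.≤-refl
    where
    go : ∀ k S → count S ℕ.< k → ∃ λ E → Reduced zs E × (∀ f → f ⟂ zs → dsc E f ≡ dsc S f)
    go (suc k) S (ℕ.s≤s lt) with Fin.any? (λ x → (S x Bool.≟ true) ×-dec line-balanced? zs S x)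
    ... | no none = S , (λ x Sx bal → none (x , Sx , bal)) , λ _ _ → refl
    ... | yes (x , Sx , bal) with go k (S ∖cl (V x ∷ zs)) (ℕ.<-≤-trans (count-< (λ j → ∧⁻ˡ) x Sx (∖cl-false {S} {V x ∷ zs} ∈cl-head)) lt)
    ... | E , red , same = E , red , λ f f⟂ → trans (same f f⟂) (begin
          dsc (S ∖cl (V x ∷ zs)) f                               ≡⟨ ℤ.+-identityˡ _ ⟨
          0ℤ ℤ.+ dsc (S ∖cl (V x ∷ zs)) f                        ≡⟨ cong (ℤ._+ dsc (S ∖cl (V x ∷ zs)) f) (bal f f⟂) ⟨
          dsc (S ∩cl (V x ∷ zs)) f ℤ.+ dsc (S ∖cl (V x ∷ zs)) f  ≡⟨ sum-+ (term f) ⟨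
          dsc S f                                                ∎)
      where
      term : ∀ f j → restrict S (σ f) j ≡
        restrict (S ∩cl (V x ∷ zs)) (σ f) j ℤ.+ restrict (S ∖cl (V x ∷ zs)) (σ f) j
      term f j with S j | does (V j ∈cl? (V x ∷ zs))
      ... | false | _ = refl
      ... | true | true = sym (ℤ.+-identityʳ _)
      ... | true | false = sym (ℤ.+-identityˡ _)

-- Slopes in a pencil of functionals: balanced contractions force rank at most 2.

module DiscrepancyBound (F : OrderedField) {a n : ℕ} (V : Geometry.Config F a n) where
  open OrderedField F
  open Geometry F
  open Configurations F V

  reduced⇒∉cl : ∀ {zs S x} → Reduced zs S → S x ≡ true → ¬ V x ∈cl zs
  reduced⇒∉cl {zs} {S} {x} red Sx x∈ = red x Sx (loop-balanced {zs} {S} {x} x∈)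

  -- After choosing generic f and g, the slope g/f orders the lines of S.  In each plane through zs
  -- balance at the two lowest lines makes their signed multiplicities opposite.
  module Pencil (zs : List (Vector a)) (S : Subfamily n) (red : Reduced zs S)
                (bal : ∀ w → S w ≡ true → Balanced (V w ∷ zs) S) where

    f : Vector a
    f = proj₁ (genericOn zs)

    f⟂ : f ⟂ zs
    f⟂ = proj₁ (proj₂ (genericOn zs))

    f≢0 : ∀ {j} → S j ≡ true → Nonzero (f · V j)
    f≢0 {j} Sj = proj₂ (proj₂ (genericOn zs)) j (reduced⇒∉cl red Sj)

    -- The combination of `V i` and `V j` killed by `f`. For `i` and `j` in `S` it lies in the span
    -- of `zs` exactly when the two vectors are parallel modulo `zs`, so a `g` generic for all of
    -- these gives distinct lines distinct slopes.
    determinant : Fin n → Fin n → Vector a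
    determinant i j = (zeroVector +[ f · V i ] V j) +[ - (f · V j) ] V i

    determinant-· : ∀ h i j → h · determinant i j ≡ (f · V i) * (h · V j) + - (f · V j) * (h · V i)
    determinant-· h i j = trans (·-linearʳ h _ _ (V i)) (cong (_+ - (f · V j) * (h · V i))
      (trans (·-linearʳ h zeroVector _ (V j)) (trans (cong (_+ (f · V i) * (h · V j)) (·-zero h zeroVector λ _ → refl)) (+-identityˡ _))))

    chosen : ∃ λ g → g ⟂ zs × (∀ {u} → u ∈ cartesianProductWith determinant (allFin n) (allFin n) → ¬ u ∈cl zs → Nonzero (g · u))
    chosen = generic zs (cartesianProductWith determinant (allFin n) (allFin n))

    g : Vector a
    g = proj₁ chosen

    g⟂ : g ⟂ zs
    g⟂ = proj₁ (proj₂ chosen)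

    θ : Fin n → Carrier
    θ j with f · V j ≟ 0#
    -- A default value; by `f≢0` it is never met on `S`.
    ... | yes _ = 0#
    ... | no nz = (g · V j) * ((f · V j) ⁻¹) nz

    θ-slope : ∀ {j} → S j ≡ true → g · V j ≡ θ j * (f · V j)
    θ-slope {j} Sj with f · V j ≟ 0#
    ... | yes z = ⊥-elim (f≢0 Sj z)
    ... | no nz = x≡xy⁻¹y nz

    -- Equal slopes make `g` vanish on the determinant of `i` and `j`, which by genericity then lies
    -- in the span of `zs`.
    θ≡⇒∈cl : ∀ {i j} → S i ≡ true → S j ≡ true → θ i ≡ θ j → V j ∈cl (V i ∷ zs)
    θ≡⇒∈cl {i} {j} Si Sj e = from-determinant (decidable-stable (determinant i j ∈cl? zs) λ ∉ →
        proj₂ (proj₂ chosen) (∈-cartesianProductWith⁺ determinant (∈-allFin i) (∈-allFin j)) ∉ g-kills)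
      where
      g-kills : g · determinant i j ≡ 0#
      g-kills = begin
        g · determinant i j                                                   ≡⟨ determinant-· g i j ⟩
        (f · V i) * (g · V j) + - (f · V j) * (g · V i)
          ≡⟨ cong₂ (λ x y → (f · V i) * x + - (f · V j) * y) (θ-slope Sj) (θ-slope Si) ⟩
        (f · V i) * (θ j * (f · V j)) + - (f · V j) * (θ i * (f · V i))
          ≡⟨ cong (λ t → (f · V i) * (θ j * (f · V j)) + - (f · V j) * (t * (f · V i))) e ⟩
        (f · V i) * (θ j * (f · V j)) + - (f · V j) * (θ j * (f · V i))
          ≡⟨ cong ((f · V i) * (θ j * (f · V j)) +_) (-‿distribˡ-* _ _) ⟨
        (f · V i) * (θ j * (f · V j)) + - ((f · V j) * (θ j * (f · V i)))
          ≡⟨ cong (λ t → t + - ((f · V j) * (θ j * (f · V i)))) (swap (f · V i) (θ j) (f · V j)) ⟩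
        (f · V j) * (θ j * (f · V i)) + - ((f · V j) * (θ j * (f · V i)))     ≡⟨ -‿inverseʳ _ ⟩
        0#                                                                    ∎
        where
        swap : ∀ x y z → x * (y * z) ≡ z * (y * x)
        swap x y z = trans (*-comm x _) (trans (cong (_* x) (*-comm y z)) (*-assoc z y x))
      from-determinant : determinant i j ∈cl zs → V j ∈cl (V i ∷ zs)
      from-determinant d∈ h (hi ∷ h⟂) = *-cancel (trans (*-comm _ (f · V i))
        (trans (sym (trans (determinant-· h i j) (a+c*0≡a hi))) (d∈ h h⟂))) (f≢0 Si)

    ∈cl⇒θ≡ : ∀ {i j} → S i ≡ true → S j ≡ true → V j ∈cl (V i ∷ zs) → θ j ≡ θ i
    ∈cl⇒θ≡ {i} {j} Si Sj j∈ with scale-to-1 f⟂ (f≢0 Si)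
    ... | f′ , s@(f′⟂ , _) = *-cancelʳ (begin
        θ j * (f · V j)                    ≡⟨ θ-slope Sj ⟨
        g · V j                            ≡⟨ on-line s g⟂ j∈ ⟩
        (g · V i) * (f′ · V j)             ≡⟨ cong (_* (f′ · V j)) (θ-slope Si) ⟩
        θ i * (f · V i) * (f′ · V j)       ≡⟨ *-assoc (θ i) _ _ ⟩
        θ i * ((f · V i) * (f′ · V j))     ≡⟨ cong (θ i *_) (on-line s f⟂ j∈) ⟨
        θ i * (f · V j)                    ∎)
      where
      *-cancelʳ : ∀ {x y} → x * (f · V j) ≡ y * (f · V j) → x ≡ y
      *-cancelʳ {x} {y} e = trans (x≡xyy⁻¹ x) (trans (cong (_* ((f · V j) ⁻¹) (f≢0 Sj)) e) (sym (x≡xyy⁻¹ y)))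
        where
        x≡xyy⁻¹ : ∀ x → x ≡ x * (f · V j) * ((f · V j) ⁻¹) (f≢0 Sj)
        x≡xyy⁻¹ x = sym (trans (*-assoc x _ _) (trans (cong (x *_) (⁻¹-inverse _ _)) (*-identityʳ x)))

    -- The member of the pencil of `f` and `g` that vanishes on `V w`. Relative to `f`, it is
    -- positive on slopes above that of `w` and negative on slopes below.
    rotate : Fin n → Vector a
    rotate w = g +[ - θ w ] f

    rotate-⟂ : ∀ {w} → S w ≡ true → rotate w ⟂ (V w ∷ zs)
    rotate-⟂ {w} Sw = trans (·-linearˡ g _ f (V w)) (trans (cong (_+ - θ w * (f · V w)) (θ-slope Sw))
      (trans (cong (θ w * (f · V w) +_) (sym (-‿distribˡ-* _ _))) (-‿inverseʳ _))) ∷ ⟂-combine zs g⟂ f⟂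

    rotate-sgn : ∀ w {j} → S j ≡ true → σ (rotate w) j ≡ sgn (θ j + - θ w) ℤ.* σ f j
    rotate-sgn w {j} Sj = trans (cong sgn (trans (·-linearˡ g _ f (V j))
      (trans (cong (_+ - θ w * (f · V j)) (θ-slope Sj)) (sym (distribʳ (f · V j) (θ j) (- θ w)))))) (sgn-* _ (f · V j))

    sgn-equal : ∀ {x y} → x ≡ y → sgn (x + - y) ≡ 0ℤ
    sgn-equal {x} refl = sgn-0 (-‿inverseʳ x)

    sgn-above : ∀ {x y} → y < x → sgn (x + - y) ≡ 1ℤ
    sgn-above lt = sgn-pos (x<y⇒0<y-x lt)

    sgn-below : ∀ {x y} → x < y → sgn (x + - y) ≡ -1ℤ
    sgn-below {x} {y} lt = sgn-neg (subst (x + - y <_) (-‿inverseʳ y) (+-mono-< (- y) lt))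

    -- The signed multiplicity of the line of `x` modulo `zs`, with signs measured by `f`.
    τ : Fin n → ℤ
    τ x = dsc (S ∩cl (V x ∷ zs)) f

    τ≢0 : ∀ {x} → S x ≡ true → ¬ τ x ≡ 0ℤ
    τ≢0 {x} Sx e with scale-to-1 f⟂ (f≢0 Sx)
    ... | f′ , s@(f′⟂ , _) = red x Sx (line-balanced {zs} {S} s (begin
        dsc L f′                                  ≡⟨ dsc-scale {L} {f} {f′} _ (λ j j∈ → f′-scale j (∩cl⁻ʳ {S} j∈)) ⟩
        sgn (((f · V x) ⁻¹) (f≢0 Sx)) ℤ.* τ x     ≡⟨ cong (sgn (((f · V x) ⁻¹) (f≢0 Sx)) ℤ.*_) e ⟩
        sgn (((f · V x) ⁻¹) (f≢0 Sx)) ℤ.* 0ℤ      ≡⟨ ℤ.*-zeroʳ (sgn (((f · V x) ⁻¹) (f≢0 Sx))) ⟩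
        0ℤ                                        ∎))
      where
      L = S ∩cl (V x ∷ zs)
      f′-scale : ∀ j → V j ∈cl (V x ∷ zs) → f′ · V j ≡ ((f · V x) ⁻¹) (f≢0 Sx) * (f · V j)
      f′-scale j j∈ = sym (trans (cong (((f · V x) ⁻¹) (f≢0 Sx) *_) (on-line s f⟂ j∈))
        (trans (sym (*-assoc _ (f · V x) _)) (trans (cong (_* (f′ · V j)) (trans (*-comm _ (f · V x)) (⁻¹-inverse _ _))) (*-identityˡ _))))

    consecutive : ∀ {w c} → S w ≡ true → S c ≡ true → θ w < θ c →
      (∀ y → S y ≡ true → V y ∈cl (V c ∷ V w ∷ zs) →
        V y ∈cl (V w ∷ zs) ⊎ V y ∈cl (V c ∷ zs) ⊎ θ c < θ y) →
      τ w ℤ.+ τ c ≡ 0ℤ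
    consecutive {w} {c} Sw Sc lt above = begin
      τ w ℤ.+ τ c                           ≡⟨ ℤ.+-identityˡ _ ⟨
      0ℤ ℤ.+ (τ w ℤ.+ τ c)                  ≡⟨ cong (ℤ._+ (τ w ℤ.+ τ c)) at-c ⟨
      dsc T (rotate c) ℤ.+ (τ w ℤ.+ τ c)
        ≡⟨ cong (λ t → dsc T (rotate c) ℤ.+ t)
          (∑-distrib-+ (restrict (S ∩cl (V w ∷ zs)) (σ f)) (restrict (S ∩cl (V c ∷ zs)) (σ f))) ⟨
      dsc T (rotate c) ℤ.+ sum (λ j → restrict (S ∩cl (V w ∷ zs)) (σ f) j ℤ.+ restrict (S ∩cl (V c ∷ zs)) (σ f) j)
                                            ≡⟨ sum-+ term ⟨
      dsc T (rotate w)                      ≡⟨ balanced-line {V w ∷ zs} {S} c (bal w Sw) (rotate w) (rotate-⟂ Sw) ⟩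
      0ℤ                                    ∎
      where
      T = S ∩cl (V c ∷ V w ∷ zs)
      at-c : dsc T (rotate c) ≡ 0ℤ
      at-c = balanced-cong {V c ∷ zs} {S ∩cl (V w ∷ V c ∷ zs)} {T}
        (∩cl-cong {S} {S} {V w ∷ V c ∷ zs} {V c ∷ V w ∷ zs} (λ j j∈ Sj → Sj , ∈cl-swap j∈) (λ j j∈ Sj → Sj , ∈cl-swap j∈))
        (balanced-line {V c ∷ zs} {S} w (bal c Sc)) (rotate c) (rotate-⟂ Sc)
      in-T : ∀ {j s} x → S j ≡ true → V j ∈cl (V c ∷ V w ∷ zs) → sgn (θ j + - θ x) ≡ s → restrict T (σ (rotate x)) j ≡ s ℤ.* σ f j
      in-T {j} x Sj j∈ e = trans (if-true (∩cl⁺ {S} {V c ∷ V w ∷ zs} Sj j∈)) (trans (rotate-sgn x Sj) (cong (ℤ._* σ f j) e))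
      in-line : ∀ {j x} → S j ≡ true → V j ∈cl (V x ∷ zs) → restrict (S ∩cl (V x ∷ zs)) (σ f) j ≡ σ f j
      in-line {x = x} Sj j∈ = if-true (∩cl⁺ {S} {V x ∷ zs} Sj j∈)
      off-line : ∀ {j x} → ¬ V j ∈cl (V x ∷ zs) → restrict (S ∩cl (V x ∷ zs)) (σ f) j ≡ 0ℤ
      off-line {x = x} j∉ = if-false (∩cl-false {S} {V x ∷ zs} j∉)
      open +-*-Solver
      term : ∀ j → restrict T (σ (rotate w)) j ≡
        restrict T (σ (rotate c)) j ℤ.+ (restrict (S ∩cl (V w ∷ zs)) (σ f) j ℤ.+ restrict (S ∩cl (V c ∷ zs)) (σ f) j)
      term j with S j Bool.≟ true
      ... | no ¬Sj rewrite Bool.¬-not ¬Sj = refl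
      ... | yes Sj = by-cases (V j ∈cl? (V w ∷ zs)) (V j ∈cl? (V c ∷ zs)) (V j ∈cl? (V c ∷ V w ∷ zs))
        where
        by-cases : Dec (V j ∈cl (V w ∷ zs)) → Dec (V j ∈cl (V c ∷ zs)) → Dec (V j ∈cl (V c ∷ V w ∷ zs)) →
          restrict T (σ (rotate w)) j ≡
          restrict T (σ (rotate c)) j ℤ.+ (restrict (S ∩cl (V w ∷ zs)) (σ f) j ℤ.+ restrict (S ∩cl (V c ∷ zs)) (σ f) j)
        by-cases (yes j∈w) (yes j∈c) _ = ⊥-elim (<-irrefl (trans (sym (∈cl⇒θ≡ Sw Sj j∈w)) (∈cl⇒θ≡ Sc Sj j∈c)) lt)
        by-cases (yes j∈w) (no j∉c) _ = trans (in-T w Sj (∈cl-there j∈w) (sgn-equal (∈cl⇒θ≡ Sw Sj j∈w)))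
          (sym (trans (cong₂ ℤ._+_ (in-T c Sj (∈cl-there j∈w) (sgn-below (subst (_< θ c) (sym (∈cl⇒θ≡ Sw Sj j∈w)) lt)))
                                   (cong₂ ℤ._+_ (in-line {x = w} Sj j∈w) (off-line {x = c} j∉c)))
            (solve 1 (λ x → con -1ℤ :* x :+ (x :+ con 0ℤ) := con 0ℤ :* x) refl (σ f j))))
        by-cases (no j∉w) (yes j∈c) _ = trans
          (in-T w Sj (∈cl-swap (∈cl-there j∈c)) (sgn-above (subst (θ w <_) (sym (∈cl⇒θ≡ Sc Sj j∈c)) lt)))
          (sym (trans (cong₂ ℤ._+_ (in-T c Sj (∈cl-swap (∈cl-there j∈c)) (sgn-equal (∈cl⇒θ≡ Sc Sj j∈c)))
                                   (cong₂ ℤ._+_ (off-line {x = w} j∉w) (in-line {x = c} Sj j∈c)))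
            (solve 1 (λ x → con 0ℤ :* x :+ (con 0ℤ :+ x) := con 1ℤ :* x) refl (σ f j))))
        by-cases (no j∉w) (no j∉c) (no j∉) = trans (if-false (∩cl-false {S} {V c ∷ V w ∷ zs} j∉))
          (sym (cong₂ ℤ._+_ (if-false (∩cl-false {S} {V c ∷ V w ∷ zs} j∉)) (cong₂ ℤ._+_ (off-line {x = w} j∉w) (off-line {x = c} j∉c))))
        by-cases (no j∉w) (no j∉c) (yes j∈) with above j Sj j∈
        ... | inj₁ j∈w = ⊥-elim (j∉w j∈w)
        ... | inj₂ (inj₁ j∈c) = ⊥-elim (j∉c j∈c)
        ... | inj₂ (inj₂ c<j) = trans (in-T w Sj j∈ (sgn-above (<-trans lt c<j)))
          (sym (trans (cong₂ ℤ._+_ (in-T c Sj j∈ (sgn-above c<j)) (cong₂ ℤ._+_ (off-line {x = w} j∉w) (off-line {x = c} j∉c)))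
            (ℤ.+-identityʳ _)))

    Outside : List (Vector a) → Fin n → Set
    Outside M j = S j ≡ true × ¬ V j ∈cl M

    outside? : ∀ M j → Dec (Outside M j)
    outside? M j = (S j Bool.≟ true) ×-dec ¬? (V j ∈cl? M)

    above-minimum : ∀ {M m} → Outside M m → (∀ j → Outside M j → ¬ θ j < θ m) →
      ∀ y → Outside M y → V y ∈cl (V m ∷ zs) ⊎ θ m < θ y
    above-minimum {M} {m} (Sm , _) least y out@(Sy , _) with compare (θ m) (θ y)
    ... | tri< lt _ _ = inj₂ lt
    ... | tri≈ _ e _ = inj₁ (θ≡⇒∈cl Sm Sy e)
    ... | tri> _ _ gt = ⊥-elim (least y out gt)

    -- Each hypothesis supplies candidates for the next line of least slope. Of the three vanishing
    -- pair sums, the two containing `τ c₁` minus the third leave twice `τ c₁`, which is nonzero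
    -- because `S` is reduced.
    rank-≤2 : ∃ (Outside zs) → (∀ x → ∃ (Outside (V x ∷ zs))) → (∀ x y → ∃ (Outside (V y ∷ V x ∷ zs))) → ⊥
    rank-≤2 ne₁ ne₂ ne₃ with argmin (outside? zs) θ ne₁
    ... | c₁ , out₁@(S₁ , _) , least₁ with argmin (outside? (V c₁ ∷ zs)) θ (ne₂ c₁)
    ... | c₂ , out₂@(S₂ , ∉₂) , least₂ with argmin (outside? (V c₂ ∷ V c₁ ∷ zs)) θ (ne₃ c₁ c₂)
    ... | c₃ , out₃@(S₃ , ∉₃) , least₃ = τ≢0 S₁ (2i≡0⇒i≡0 (begin
        τ c₁ ℤ.+ τ c₁
          ≡⟨ solve 3 (λ x y z → x :+ x := (x :+ y) :+ (x :+ z) :- (y :+ z)) refl (τ c₁) (τ c₂) (τ c₃) ⟩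
        (τ c₁ ℤ.+ τ c₂) ℤ.+ (τ c₁ ℤ.+ τ c₃) ℤ.- (τ c₂ ℤ.+ τ c₃) ≡⟨ cong₂ ℤ._-_ (cong₂ ℤ._+_ τ₁₂ τ₁₃) τ₂₃ ⟩
        0ℤ                                                      ∎))
      where
      open +-*-Solver
      2i≡0⇒i≡0 : ∀ {i} → i ℤ.+ i ≡ 0ℤ → i ≡ 0ℤ
      2i≡0⇒i≡0 {i} e with ℤ.i*j≡0⇒i≡0∨j≡0 (ℤ.+ 2) (trans (solve 1 (λ x → con (ℤ.+ 2) :* x := x :+ x) refl i) e)
      ... | inj₂ z = z
      below : ∀ {x m} → S x ≡ true → S m ≡ true → ¬ θ m < θ x → ¬ V m ∈cl (V x ∷ zs) → θ x < θ m
      below {x} {m} Sx Sm nlt m∉ with compare (θ x) (θ m)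
      ... | tri< lt _ _ = lt
      ... | tri≈ _ e _ = ⊥-elim (m∉ (θ≡⇒∈cl Sx Sm e))
      ... | tri> _ _ gt = ⊥-elim (nlt gt)
      ∉₃₁ : ¬ V c₃ ∈cl (V c₁ ∷ zs)
      ∉₃₁ = ∉₃ ∘ ∈cl-there
      ∉₃₂ : ¬ V c₃ ∈cl (V c₂ ∷ zs)
      ∉₃₂ = ∉₃ ∘ ∈cl-swap ∘ ∈cl-there
      τ₁₂ : τ c₁ ℤ.+ τ c₂ ≡ 0ℤ
      τ₁₂ = consecutive S₁ S₂ (below S₁ S₂ (least₁ c₂ (S₂ , reduced⇒∉cl red S₂)) ∉₂) cases
        where
        cases : ∀ y → S y ≡ true → V y ∈cl (V c₂ ∷ V c₁ ∷ zs) → V y ∈cl (V c₁ ∷ zs) ⊎ V y ∈cl (V c₂ ∷ zs) ⊎ θ c₂ < θ y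
        cases y Sy _ with V y ∈cl? (V c₁ ∷ zs)
        ... | yes y∈ = inj₁ y∈
        ... | no y∉ = inj₂ (above-minimum out₂ least₂ y (Sy , y∉))
      f₀ : ∃ (Separates (V c₂ ∷ V c₁ ∷ zs) (V c₃))
      f₀ = ∉cl⇒separates ∉₃
      cases : ∀ {x} → Separates (V x ∷ zs) (V c₃) (proj₁ f₀) → ∀ y → S y ≡ true → V y ∈cl (V c₃ ∷ V x ∷ zs) →
        V y ∈cl (V x ∷ zs) ⊎ V y ∈cl (V c₃ ∷ zs) ⊎ θ c₃ < θ y
      cases s y Sy y∈₃ with V y ∈cl? (V c₂ ∷ V c₁ ∷ zs)
      -- The plane of `c₃` and `x` meets the plane of `c₁` and `c₂` only in the line of `x`: `f₀`
      -- vanishes on the second plane but not on `V c₃`, so `c₃` drops out.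
      ... | yes y∈ = inj₁ (∈cl-drop s (y∈ (proj₁ f₀) (proj₁ (proj₂ f₀))) y∈₃)
      ... | no y∉ = inj₂ (above-minimum out₃ least₃ y (Sy , y∉))
      τ₁₃ : τ c₁ ℤ.+ τ c₃ ≡ 0ℤ
      τ₁₃ with f₀ | cases {c₁}
      ... | _ , (_ ∷ ⟂₁) , e | cs = consecutive S₁ S₃ (below S₁ S₃ (least₁ c₃ (S₃ , reduced⇒∉cl red S₃)) ∉₃₁) (cs (⟂₁ , e))
      τ₂₃ : τ c₂ ℤ.+ τ c₃ ≡ 0ℤ
      τ₂₃ with f₀ | cases {c₂}
      ... | _ , (⟂₂ ∷ _ ∷ ⟂₀) , e | cs = consecutive S₂ S₃ (below S₂ S₃ (least₂ c₃ (S₃ , ∉₃₁)) ∉₃₂) (cs (⟂₂ ∷ ⟂₀ , e))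

-- The rank bound by induction on the discrepancy.

module SpanningBound (F : OrderedField) {a n : ℕ} (V : Geometry.Config F a n) where
  open OrderedField F
  open Geometry F
  open Configurations F V
  open DiscrepancyBound F V

  -- The contraction of `S` by `zs` has rank at most `k`, expressed by generators so that the bounds
  -- for a flat and for its contraction combine by concatenation.
  SpannedBy : ℕ → List (Vector a) → Subfamily n → Set
  SpannedBy k zs S = ∃ λ ys → length ys ℕ.≤ k × (∀ x → S x ≡ true → V x ∈cl (ys ++ zs))

  outside-span : ∀ {k zs S} → ¬ SpannedBy k zs S → ∀ ys → length ys ℕ.≤ k → ∃ λ x → S x ≡ true × ¬ V x ∈cl (ys ++ zs)
  outside-span {k} {zs} {S} ns ys le with Fin.any? (λ x → (S x Bool.≟ true) ×-dec ¬? (V x ∈cl? (ys ++ zs)))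
  ... | yes w = w
  ... | no none = ⊥-elim (ns (ys , le , λ x Sx → decidable-stable (V x ∈cl? (ys ++ zs)) λ x∉ → none (x , Sx , x∉)))

  -- Stated for contractions by an arbitrary `zs`, since the induction on `D` is applied to a flat
  -- and also to the contraction by it. The double negation comes from the maxima of `¬¬-max`.
  bounded⇒spanned : ∀ D zs S → Reduced zs S → (∀ f → f ⟂ zs → dsc S f ℤ.≤ ℤ.+ D) → ¬ ¬ SpannedBy (2 ℕ.* D) zs S
  bounded⇒spanned = <-rec _ step
    where
    step : ∀ D → (∀ {D′} → D′ ℕ.< D → ∀ zs S → Reduced zs S → (∀ f → f ⟂ zs → dsc S f ℤ.≤ ℤ.+ D′) → ¬ ¬ SpannedBy (2 ℕ.* D′) zs S) →
      ∀ zs S → Reduced zs S → (∀ f → f ⟂ zs → dsc S f ℤ.≤ ℤ.+ D) → ¬ ¬ SpannedBy (2 ℕ.* D) zs S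
    step zero IH zs S red ub unspanned with outside-span {0} {zs} {S} unspanned [] ℕ.z≤n
    -- With bound 0 everything is balanced, including the line of `x`, against `red`.
    ... | x , Sx , _ = red x Sx (balanced-line {zs} {S} x (nonpositive⇒balanced {zs} {S} ub))
    step D@(suc D-1) IH zs S red ub unspanned =
      -- As `D` is positive, at most two generators are within the `2 * D` that fail to span `S`.
      rank-≤2 (outside [] ℕ.z≤n) (λ x → outside (V x ∷ []) (ℕ.s≤s ℕ.z≤n))
              (λ x y → outside (V y ∷ V x ∷ []) (ℕ.*-monoʳ-≤ 2 (ℕ.s≤s ℕ.z≤n)))
      where
      outside : ∀ ys → length ys ℕ.≤ 2 ℕ.* D → ∃ λ x → S x ≡ true × ¬ V x ∈cl (ys ++ zs)
      outside = outside-span {2 ℕ.* D} {zs} {S} unspanned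

      flat : List (Fin n) → List (Vector a)
      flat js = map V js ++ zs

      -- Induction on the number of members of `S` outside the flat, bounded by `k`. `D₁` and `D₂`
      -- are the maximal discrepancies of the flat and of its contraction. `D₁` is positive because
      -- the flat contains the line of `j`; if `D₂` is positive too, both are smaller than `D` and
      -- the outer induction applies. The double negations vanish because the goal is an equation
      -- between integers.
      flat-balanced : ∀ k j js → All (λ i → S i ≡ true) (j ∷ js) → count (S ∖cl flat (j ∷ js)) ℕ.< k → Balanced (flat (j ∷ js)) S
      flat-balanced (suc k) j js js⊆S (ℕ.s≤s lt) = λ f f⟂ → decidable-stable (dsc S f ℤ.≟ 0ℤ) λ ne →
        ¬¬-max (λ (f , _) → dsc S⋒ f) (zeroVector , zeroVector-⟂ zs) (ℤ.≤-reflexive (sym (dsc-zeroVector S⋒))) D bound₁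
        λ { (D₁ , (f₁ , le₁) , ub₁) →
        ¬¬-max (λ (f , _) → dsc S f) (zeroVector , zeroVector-⟂ M) (ℤ.≤-reflexive (sym (dsc-zeroVector S))) D
          (λ (f , f⟂) → ub f (All.++⁻ʳ (map V (j ∷ js)) f⟂))
        λ { (D₂ , (f₂ , le₂) , ub₂) → split D₁ D₂ f₁ le₁ ub₁ f₂ le₂ ub₂ λ bal → ne (bal f f⟂) } }
        where
        M = flat (j ∷ js)
        S⋒ = S ∩cl M

        M∋ : ∀ {i} → i ∈ (j ∷ js) → V i ∈cl M
        M∋ i∈ f f⟂ = All.lookup f⟂ (∈-++⁺ˡ (∈-map⁺ V i∈))

        Sj : S j ≡ true
        Sj = All.head js⊆S

        bound₁ : ∀ ((f , _) : ∃ λ f → f ⟂ zs) → dsc S⋒ f ℤ.≤ ℤ.+ D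
        -- The zero functional on the contraction contributes 0, so the flat inherits the bound of
        -- `S`.
        bound₁ (f , f⟂) with dsc-flat+contraction {zs} {map V (j ∷ js)} {S} f⟂ (zeroVector-⟂ M)
        ... | h , h⟂ , le = ℤ.≤-trans
          (subst (ℤ._≤ dsc S h) (trans (cong (λ t → dsc S⋒ f ℤ.+ t) (dsc-zeroVector S)) (ℤ.+-identityʳ _)) le) (ub h h⟂)

        same-line : ∀ {x} → V x ∈cl M → ∀ i → (S⋒ ∩cl (V x ∷ zs)) i ≡ (S ∩cl (V x ∷ zs)) i
        same-line {x} x∈ = ∩cl-cong {S⋒} {S} {V x ∷ zs} {V x ∷ zs}
          (λ i i∈ e → ∩cl⁻ˡ {S} {M} e , i∈)
          (λ i i∈ Si → ∩cl⁺ {S} {M} Si (λ f f⟂ → i∈ f (x∈ f f⟂ ∷ All.++⁻ʳ (map V (j ∷ js)) f⟂)) , i∈)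

        red⋒ : Reduced zs S⋒
        red⋒ x e bal = red x (∩cl⁻ˡ {S} {M} e) (balanced-cong {zs} {S⋒ ∩cl (V x ∷ zs)} {S ∩cl (V x ∷ zs)} (same-line (∩cl⁻ʳ {S} {M} e)) bal)

        -- E is what remains of the contraction by the flat after cancellation.  A vector x of S outside
        -- the flat and the span of E exists by counting; contracting it as well keeps E intact, so E is empty.
        cancelled : ∀ {D₁ D₂} E → D₁ ℕ.+ D₂ ℕ.≤ D → Reduced M E → (∀ f → f ⟂ M → dsc E f ≡ dsc S f) →
          SpannedBy (2 ℕ.* D₁) zs S⋒ → SpannedBy (2 ℕ.* D₂) M E → Balanced M S
        cancelled {D₁} {D₂} E D₁+D₂≤D redE same (ms , ms≤ , ms-span) (es , es≤ , es-span) f f⟂ =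
          trans (sym (same f f⟂)) (sum-zero (λ e → if-false (E-empty e)))
          where
          -- The generators of `E` and of the flat together are too few to span `S`; this produces
          -- `x`.
          len : length (es ++ ms) ℕ.≤ 2 ℕ.* D
          len = ℕ.≤-trans (ℕ.≤-reflexive (List.length-++ es)) (ℕ.≤-trans (ℕ.+-mono-≤ es≤ ms≤)
            (ℕ.≤-trans (ℕ.≤-reflexive (trans (sym (ℕ.*-distribˡ-+ 2 D₂ D₁)) (cong (2 ℕ.*_) (ℕ.+-comm D₂ D₁)))) (ℕ.*-monoʳ-≤ 2 D₁+D₂≤D)))
          found = outside (es ++ ms) len
          x = proj₁ found
          Sx = proj₁ (proj₂ found)
          sep = ∉cl⇒separates (proj₂ (proj₂ found))
          u = proj₁ sep
          ux = proj₂ (proj₂ sep)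
          u⟂ : u ⟂ (es ++ ms) × u ⟂ zs
          u⟂ = All.++⁻ (es ++ ms) (proj₁ (proj₂ sep))
          u⟂es = All.++⁻ˡ es (proj₁ u⟂)
          u⟂ms = All.++⁻ʳ es (proj₁ u⟂)
          -- `u` vanishes on `ms` and `zs`, hence on every member of `S` in the flat, in particular
          -- on the generators of `M`.
          u⟂M : u ⟂ M
          u⟂M = All.++⁺ (All.map⁺ (All.tabulate λ {i} i∈ →
            ms-span i (∩cl⁺ {S} {M} (All.lookup js⊆S i∈) (M∋ i∈)) u (All.++⁺ u⟂ms (proj₂ u⟂)))) (proj₂ u⟂)
          u-kills : ∀ {y} → E y ≡ true → u · V y ≡ 0#
          u-kills {y} Ey = es-span y Ey u (All.++⁺ u⟂es u⟂M)
          x∉M : ¬ V x ∈cl M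
          x∉M x∈ = 1≢0 (trans (sym ux) (x∈ u u⟂M))
          fewer : count (S ∖cl (V x ∷ M)) ℕ.< count (S ∖cl M)
          fewer = count-< (λ i e → ∖cl⁺ {S} {M} (∧⁻ˡ e) (∖cl⁻ {S} {V x ∷ M} e ∘ ∈cl-there))
            x (∖cl⁺ {S} {M} Sx x∉M) (∖cl-false {S} {V x ∷ M} ∈cl-head)
          balE : Balanced (V x ∷ M) E
          balE h (hx ∷ h⟂) = trans (same h h⟂) (flat-balanced k x (j ∷ js) (Sx ∷ js⊆S) (ℕ.<-≤-trans fewer lt) h (hx ∷ h⟂))
          -- `u` vanishes on `E` and on `M` but not on `V x`. So contracting `x` merges no lines of
          -- `E`, and `h` may be replaced by `eliminate u (V x) h`, which agrees with it on `E` and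
          -- vanishes on `V x`; there the induction hypothesis gives balance.
          line : ∀ e → E e ≡ true → Balanced M (E ∩cl (V e ∷ M))
          line e Ee h h⟂ = trans
            (dsc-cong {E ∩cl (V e ∷ M)} {E ∩cl (V e ∷ V x ∷ M)} {h} {eliminate u (V x) h}
              (∩cl-cong {E} {E} {V e ∷ M} {V e ∷ V x ∷ M}
                (λ i i∈ Ei → Ei , ∈cl-swap (∈cl-there i∈))
                (λ i i∈ Ei → Ei , ∈cl-drop (u-kills Ee ∷ u⟂M , ux) (u-kills Ei) (∈cl-swap i∈)))
              (λ i i∈ → sym (eliminate-kernel {f = u} {V x} h (u-kills (∩cl⁻ˡ {E} {V e ∷ M} i∈)))))
            (balanced-line {V x ∷ M} {E} e balE (eliminate u (V x) h) (eliminate-⟂ (u⟂M , ux) h⟂))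
          E-empty : ∀ e → E e ≡ false
          E-empty e = Bool.¬-not λ Ee → redE e Ee (line e Ee)

        split : ∀ D₁ D₂ (f₁ : ∃ λ f → f ⟂ zs) → ℤ.+ D₁ ℤ.≤ dsc S⋒ (proj₁ f₁) → (∀ ((f , _) : ∃ λ f → f ⟂ zs) → dsc S⋒ f ℤ.≤ ℤ.+ D₁) →
          (f₂ : ∃ λ f → f ⟂ M) → ℤ.+ D₂ ℤ.≤ dsc S (proj₁ f₂) → (∀ ((f , _) : ∃ λ f → f ⟂ M) → dsc S f ℤ.≤ ℤ.+ D₂) →
          ¬ ¬ Balanced M S
        split zero D₂ _ _ ub₁ _ _ _ _ =
          -- A flat of discrepancy 0 would have a balanced line through `j`.
          red⋒ j (∩cl⁺ {S} {M} Sj (M∋ (here refl))) (balanced-line {zs} {S⋒} j (nonpositive⇒balanced {zs} {S⋒} λ f f⟂ → ub₁ (f , f⟂)))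
        split (suc D₁) zero _ _ _ _ _ ub₂ unbal = unbal (nonpositive⇒balanced {M} {S} λ f f⟂ → ub₂ (f , f⟂))
        split (suc D₁) (suc D₂) (f₁ , f₁⟂) le₁ ub₁ (f₂ , f₂⟂) le₂ ub₂ unbal with reduce M S
        ... | E , redE , same =
          IH {suc D₁} (ℕ.≤-trans (ℕ.s≤s (ℕ.≤-trans (ℕ.m≤m+n (suc D₁) D₂) (ℕ.≤-reflexive (sym (ℕ.+-suc D₁ D₂))))) total)
            zs S⋒ red⋒ (λ f f⟂ → ub₁ (f , f⟂)) λ sp₁ →
          IH {suc D₂} (ℕ.≤-trans (ℕ.s≤s (ℕ.m≤n+m (suc D₂) D₁)) total)
            M E redE (λ f f⟂ → subst (ℤ._≤ ℤ.+ suc D₂) (sym (same f f⟂)) (ub₂ (f , f⟂))) λ sp₂ →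
          unbal (cancelled {suc D₁} {suc D₂} E total redE same sp₁ sp₂)
          where
          total : suc D₁ ℕ.+ suc D₂ ℕ.≤ D
          total with dsc-flat+contraction {zs} {map V (j ∷ js)} {S} f₁⟂ f₂⟂
          ... | h , h⟂ , le = ℤ.drop‿+≤+ (ℤ.≤-trans (ℤ.+-mono-≤ le₁ le₂) (ℤ.≤-trans le (ub h h⟂)))

      -- The pencil argument asks for balance only at flats generated by one vector; larger flats
      -- served the induction.
      open Pencil zs S red (λ w Sw → flat-balanced (suc (count (S ∖cl flat (w ∷ [])))) w [] (Sw ∷ []) ℕ.≤-refl)

-- Independent families against spanning lists.

module Dimension (F : OrderedField) {n : ℕ} where
  open OrderedField F
  open Geometry F
  open LinearAlgebra F
  open Counting F

  basis-diagonal : ∀ {k} (i : Fin k) → basis i i ≡ 1#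
  basis-diagonal zero = refl
  basis-diagonal (suc i) = basis-diagonal i

  basis-off-diagonal : ∀ {k} (i j : Fin k) → ¬ j ≡ i → basis i j ≡ 0#
  basis-off-diagonal zero zero ne = ⊥-elim (ne refl)
  basis-off-diagonal zero (suc j) ne = refl
  basis-off-diagonal (suc i) zero ne = refl
  basis-off-diagonal (suc i) (suc j) ne = basis-off-diagonal i j (ne ∘ cong suc)

  count-none : ∀ {k} {S : Fin k → Bool} → (∀ j → S j ≡ false) → count S ≡ 0
  count-none {zero} _ = refl
  count-none {suc k} none rewrite none zero = count-none (none ∘ suc)

  count-remove : ∀ {k} (S : Fin k → Bool) i → count S ℕ.≤ suc (count (λ j → S j ∧ not (does (j Fin.≟ i))))
  count-remove {suc k} S zero = ℕ.≤-trans (ℕ.+-mono-≤ (at-most-1 (S zero)) (count-≤ {p = S ∘ suc} λ j Sj → trans (Bool.∧-identityʳ _) Sj))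
    (ℕ.s≤s (ℕ.m≤n+m _ (if S zero ∧ false then 1 else 0)))
    where
    at-most-1 : ∀ b → (if b then 1 else 0) ℕ.≤ 1
    at-most-1 true = ℕ.s≤s ℕ.z≤n
    at-most-1 false = ℕ.z≤n
  count-remove {suc k} S (suc i) with S zero
  ... | true = ℕ.s≤s (count-remove (S ∘ suc) i)
  ... | false = count-remove (S ∘ suc) i

  -- Steinitz by induction on the list. If `ys` alone does not span `S`, some `x` of `S` can be
  -- exchanged for `y`; projecting the remaining vectors along `V x` leaves an independent family
  -- spanned by `ys`. An empty list spans only zero vectors, each of which would give a nontrivial
  -- relation.
  independent⇒count≤length : ∀ {a} ys (V : Config a n) S → LinIndep V S → (∀ j → S j ≡ true → V j ∈cl ys) → count S ℕ.≤ length ys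
  independent⇒count≤length [] V S ind span = ℕ.≤-reflexive (count-none λ j → Bool.¬-not λ Sj →
    1≢0 (trans (sym (basis-diagonal j)) (ind (basis j)
      (λ i ¬Si → basis-off-diagonal j i λ { refl → Bool.not-¬ ¬Si Sj })
      (λ i → trans (basis-· j (λ l → V l i)) (trans (sym (basis-· i (V j))) (span j Sj (basis i) []))) j)))
  independent⇒count≤length {a} (y ∷ ys) V S ind span with Fin.any? (λ x → (S x Bool.≟ true) ×-dec ¬? (V x ∈cl? ys))
  ... | no none = ℕ.m≤n⇒m≤1+n (independent⇒count≤length ys V S ind λ j Sj → decidable-stable (V j ∈cl? ys) λ j∉ → none (j , Sj , j∉))
  ... | yes (x , Sx , x∉) with ∉cl⇒separates x∉
  ... | f , s@(f⟂ , fx) = ℕ.≤-trans (count-remove S x) (ℕ.s≤s (independent⇒count≤length ys V′ S′ ind′ span′))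
    where
    V′ : Config a n
    V′ j = V j +[ - (f · V j) ] V x
    S′ : Subfamily n
    S′ j = S j ∧ not (does (j Fin.≟ x))
    y∈ : y ∈cl (V x ∷ ys)
    y∈ = exchange (span x Sx) x∉
    span′ : ∀ j → S′ j ≡ true → V′ j ∈cl ys
    span′ j S′j g g⟂ = begin
      g · V′ j                                           ≡⟨ ·-linearʳ g (V j) _ (V x) ⟩
      g · V j + - (f · V j) * (g · V x)
        ≡⟨ cong (_+ - (f · V j) * (g · V x))
          (on-line s g⟂ λ { h (hx ∷ h⟂) → span j (∧⁻ˡ S′j) h (y∈ h (hx ∷ h⟂) ∷ h⟂) }) ⟩
      (g · V x) * (f · V j) + - (f · V j) * (g · V x)
        ≡⟨ cong ((g · V x) * (f · V j) +_) (trans (-a*b≡-b*a (f · V j) (g · V x)) (sym (-‿distribˡ-* _ _))) ⟩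
      (g · V x) * (f · V j) + - ((g · V x) * (f · V j))  ≡⟨ -‿inverseʳ _ ⟩
      0#                                                 ∎
    S′x : S′ x ≡ false
    S′x rewrite dec-true (x Fin.≟ x) refl = Bool.∧-zeroʳ (S x)
    ind′ : LinIndep V′ S′
    ind′ c supp dep j with j Fin.≟ x
    ... | yes refl = supp j S′x
    ... | no j≢x = trans (sym (a+c*0≡a {c j} {m} (basis-off-diagonal x j j≢x))) (ind d d-supp d-dep j)
      where
      m : Carrier
      -- The coefficient of `V x` that turns a relation among the projected vectors into one among
      -- the original vectors.
      m = Σ[ (λ j → c j * - (f · V j)) ]
      d : Fin n → Carrier
      d j = c j + m * basis x j
      d-supp : ∀ j → S j ≡ false → d j ≡ 0#
      d-supp j ¬Sj = trans (a+c*0≡a (basis-off-diagonal x j λ { refl → Bool.not-¬ ¬Sj Sx })) (supp j (cong (_∧ not (does (j Fin.≟ x))) ¬Sj))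
      d-dep : ∀ i → Σ[ (λ j → d j * V j i) ] ≡ 0#
      d-dep i = begin
        Σ[ (λ j → d j * V j i) ]
          ≡⟨ Σ-linear m (λ j → trans (distribʳ (V j i) (c j) _) (cong (c j * V j i +_) (*-assoc m _ _))) ⟩
        Σ[ (λ j → c j * V j i) ] + m * (basis x · (λ j → V j i))
          ≡⟨ cong (λ t → Σ[ (λ j → c j * V j i) ] + m * t) (basis-· x (λ j → V j i)) ⟩
        Σ[ (λ j → c j * V j i) ] + m * V x i
          ≡⟨ cong (Σ[ (λ j → c j * V j i) ] +_) (*-comm m (V x i)) ⟩
        Σ[ (λ j → c j * V j i) ] + V x i * m
          ≡⟨ Σ-linear (V x i) (λ j → trans (distribˡ (c j) (V j i) _)
            (cong (c j * V j i +_) (trans (sym (*-assoc (c j) _ _)) (*-comm _ (V x i))))) ⟨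
        Σ[ (λ j → c j * V′ j i) ]                                       ≡⟨ dep i ⟩
        0#                                                              ∎

  listing : ∀ {a k} (V : Config a k) S → ∃ λ ws → length ws ≡ count S × (∀ j → S j ≡ true → V j ∈cl ws)
  listing {k = zero} V S = [] , refl , λ ()
  listing {k = suc k} V S with S zero in S0 | listing (V ∘ suc) (S ∘ suc)
  ... | true | ws , len , span = V zero ∷ ws , cong suc len , λ { zero _ → ∈cl-head ; (suc j) Sj → ∈cl-there (span j Sj) }
  ... | false | ws , len , span = ws , len , λ { zero Sz → ⊥-elim (Bool.not-¬ S0 Sz) ; (suc j) Sj → span j Sj }

-- Antipodal pairs and their removal.

module AntipodalPairs (F : OrderedField) {a n : ℕ} (V : Geometry.Config F a n) where
  open OrderedField F
  open Geometry F
  open Configurations F V public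

  closed : Vector a → Fin n → ℤ
  closed f j = if not (pos? V f j) then 1ℤ else 0ℤ

  data ClosedSign (f : Vector a) (j : Fin n) : ℤ → ℤ → Set where
    pos  : 0# < f · V j → ClosedSign f j 1ℤ 0ℤ
    null : f · V j ≡ 0# → ClosedSign f j 0ℤ 1ℤ
    neg  : f · V j < 0# → ClosedSign f j -1ℤ 1ℤ

  closedSign : ∀ f j → ClosedSign f j (σ f j) (closed f j)
  closedSign f j with sgn (f · V j) | hasSign (f · V j) | 0# <? (f · V j)
  ... | _ | pos p  | yes _ = pos p
  ... | _ | pos p  | no ¬p = ⊥-elim (¬p p)
  ... | _ | null e | yes p = ⊥-elim (<-irrefl (sym e) p)
  ... | _ | null e | no _  = null e
  ... | _ | neg p  | yes q = ⊥-elim (<-asym p q)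
  ... | _ | neg p  | no _  = neg p

  count-sum : ∀ {k} (p : Fin k → Bool) → ℤ.+ count p ≡ sum (λ j → if p j then 1ℤ else 0ℤ)
  count-sum {zero} p = refl
  count-sum {suc k} p with p zero
  ... | true = cong (λ t → 1ℤ ℤ.+ t) (count-sum (p ∘ suc))
  ... | false = trans (count-sum (p ∘ suc)) (sym (ℤ.+-identityˡ _))

  if-∧ : ∀ b {c} → (if b ∧ c then 1ℤ else 0ℤ) ≡ (if b then (if c then 1ℤ else 0ℤ) else 0ℤ)
  if-∧ true = refl
  if-∧ false = refl

  closedMinus-sum : ∀ f S → ℤ.+ closedMinusCount V f S ≡ Σ⟨ S ⟩ (closed f)
  closedMinus-sum f S = trans (count-sum (λ j → S j ∧ not (pos? V f j))) (sum-cong-≗ λ j → if-∧ (S j))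

  count-whole : ∀ {k} → count {k} (λ _ → true) ≡ k
  count-whole {zero} = refl
  count-whole {suc k} = cong suc count-whole

  plus+closed : ∀ f → plusCount V f whole ℕ.+ closedMinusCount V f whole ≡ n
  plus+closed f = complement (pos? V f)
    where
    complement : ∀ {k} (p : Fin k → Bool) → count p ℕ.+ count (not ∘ p) ≡ k
    complement {zero} p = refl
    complement {suc k} p with p zero
    ... | true = cong suc (complement (p ∘ suc))
    ... | false = trans (ℕ.+-suc _ _) (cong suc (complement (p ∘ suc)))

  disc-dsc : ∀ f → disc V f ≡ dsc whole f
  disc-dsc f = begin
    ℤ.+ plusCount V f whole ℤ.- ℤ.+ minusCount V f whole
      ≡⟨ cong (ℤ._- ℤ.+ minusCount V f whole) plus-sum ⟩
    (dsc whole f ℤ.+ ℤ.+ minusCount V f whole) ℤ.- ℤ.+ minusCount V f whole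
      ≡⟨ solve 2 (λ x y → (x :+ y) :- y := x) refl (dsc whole f) (ℤ.+ minusCount V f whole) ⟩
    dsc whole f ∎
    where
    open +-*-Solver
    term : ∀ j → (if pos? V f j then 1ℤ else 0ℤ) ≡ σ f j ℤ.+ (if neg? V f j then 1ℤ else 0ℤ)
    term j with sgn (f · V j) | hasSign (f · V j) | 0# <? (f · V j) | (f · V j) <? 0#
    ... | _ | pos p  | yes _ | no _ = refl
    ... | _ | pos p  | no ¬p | _ = ⊥-elim (¬p p)
    ... | _ | pos p  | yes _ | yes q = ⊥-elim (<-asym p q)
    ... | _ | null e | yes p | _ = ⊥-elim (<-irrefl (sym e) p)
    ... | _ | null e | no _ | yes p = ⊥-elim (<-irrefl e p)
    ... | _ | null e | no _ | no _ = refl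
    ... | _ | neg p  | yes q | _ = ⊥-elim (<-asym p q)
    ... | _ | neg p  | no _ | yes _ = refl
    ... | _ | neg p  | no _ | no ¬p = ⊥-elim (¬p p)
    plus-sum : ℤ.+ plusCount V f whole ≡ dsc whole f ℤ.+ ℤ.+ minusCount V f whole
    plus-sum = trans (count-sum (pos? V f)) (trans (sum-+ term) (cong (λ t → dsc whole f ℤ.+ t) (sym (count-sum (neg? V f)))))

  NowhereZero : Vector a → Set
  NowhereZero f = ∀ j → Nonzero (f · V j)

  -- Without zeros each vector has sign 1 and lies outside the closed negative side, or has sign -1
  -- and lies in it. This identity links discrepancy with codegree.
  dsc+2closed : ∀ {f} → NowhereZero f → ∀ S →
    dsc S f ℤ.+ (ℤ.+ closedMinusCount V f S ℤ.+ ℤ.+ closedMinusCount V f S) ≡ ℤ.+ count S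
  dsc+2closed {f} nz S = sym (begin
    ℤ.+ count S
      ≡⟨ count-sum S ⟩
    sum (restrict S (λ _ → 1ℤ))
      ≡⟨ sum-+ term ⟩
    dsc S f ℤ.+ sum (λ j → restrict S (closed f) j ℤ.+ restrict S (closed f) j)
      ≡⟨ cong (λ t → dsc S f ℤ.+ t) (∑-distrib-+ (restrict S (closed f)) (restrict S (closed f))) ⟩
    dsc S f ℤ.+ (Σ⟨ S ⟩ (closed f) ℤ.+ Σ⟨ S ⟩ (closed f))
      ≡⟨ cong (λ t → dsc S f ℤ.+ (t ℤ.+ t)) (closedMinus-sum f S) ⟨
    dsc S f ℤ.+ (ℤ.+ closedMinusCount V f S ℤ.+ ℤ.+ closedMinusCount V f S) ∎)
    where
    unit : ∀ j → 1ℤ ≡ σ f j ℤ.+ (closed f j ℤ.+ closed f j)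
    unit j with σ f j | closed f j | closedSign f j
    ... | _ | _ | pos _ = refl
    ... | _ | _ | null e = ⊥-elim (nz j e)
    ... | _ | _ | neg _ = refl
    term : ∀ j → restrict S (λ _ → 1ℤ) j ≡ restrict S (σ f) j ℤ.+ (restrict S (closed f) j ℤ.+ restrict S (closed f) j)
    term j with S j
    ... | true = unit j
    ... | false = refl

  pair : Fin n → Fin n → Subfamily n
  pair i j x = does (x Fin.≟ i) ∨ does (x Fin.≟ j)

  sum-single : ∀ {k} (t : Fin k → ℤ) i → sum (λ x → if does (x Fin.≟ i) then t x else 0ℤ) ≡ t i
  sum-single {suc k} t zero = trans (cong (λ s → t zero ℤ.+ s) (sum-zero {k} {λ _ → 0ℤ} λ _ → refl)) (ℤ.+-identityʳ _)
  sum-single {suc k} t (suc i) = trans (ℤ.+-identityˡ _) (sum-single (t ∘ suc) i)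

  sum-pair : ∀ {i j} → ¬ i ≡ j → ∀ t → Σ⟨ pair i j ⟩ t ≡ t i ℤ.+ t j
  sum-pair {i} {j} i≢j t = trans (sum-+ term) (cong₂ ℤ._+_ (sum-single t i) (sum-single t j))
    where
    term : ∀ x → restrict (pair i j) t x ≡ (if does (x Fin.≟ i) then t x else 0ℤ) ℤ.+ (if does (x Fin.≟ j) then t x else 0ℤ)
    term x with x Fin.≟ i | x Fin.≟ j
    ... | yes refl | yes refl = ⊥-elim (i≢j refl)
    ... | yes _ | no _ = sym (ℤ.+-identityʳ _)
    ... | no _ | yes _ = sym (ℤ.+-identityˡ _)
    ... | no _ | no _ = refl

  _∖pair_,_ : Subfamily n → Fin n → Fin n → Subfamily n
  (S ∖pair i , j) x = S x ∧ not (pair i j x)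

  sum-remove-pair : ∀ {S i j} → S i ≡ true → S j ≡ true → ¬ i ≡ j → ∀ t → Σ⟨ S ⟩ t ≡ (t i ℤ.+ t j) ℤ.+ Σ⟨ S ∖pair i , j ⟩ t
  sum-remove-pair {S} {i} {j} Si Sj i≢j t = trans (sum-+ term) (cong (ℤ._+ Σ⟨ S ∖pair i , j ⟩ t) (sum-pair i≢j t))
    where
    term : ∀ x → restrict S t x ≡ restrict (pair i j) t x ℤ.+ restrict (S ∖pair i , j) t x
    term x with x Fin.≟ i | x Fin.≟ j | S x in eq
    ... | yes refl | _ | true = sym (ℤ.+-identityʳ _)
    ... | yes refl | _ | false = ⊥-elim (Bool.not-¬ eq Si)
    ... | no _ | yes refl | true = sym (ℤ.+-identityʳ _)
    ... | no _ | yes refl | false = ⊥-elim (Bool.not-¬ eq Sj)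
    ... | no _ | no _ | true = sym (ℤ.+-identityˡ _)
    ... | no _ | no _ | false = refl

  module Matching (f₀ : Vector a) (f₀≢0 : NowhereZero f₀) where

    -- As `f₀` has no zeros on `V`, parallel vectors with opposite signs under `f₀` are negative
    -- multiples of each other. This form is decidable.
    Antipodal : Fin n → Fin n → Set
    Antipodal i j = V j ∈cl (V i ∷ []) × σ f₀ j ≡ ℤ.- σ f₀ i

    antipodal? : ∀ i j → Dec (Antipodal i j)
    antipodal? i j = (V j ∈cl? (V i ∷ [])) ×-dec (σ f₀ j ℤ.≟ ℤ.- σ f₀ i)

    -- For every functional the sign at `j` is the sign at `i` times that of the scalar relating the
    -- two vectors, which is read off by `f₁`.
    sgn-scaled : ∀ {i j} → V j ∈cl (V i ∷ []) → ∀ f → σ f₀ i ℤ.* σ f j ≡ σ f i ℤ.* σ f₀ j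
    sgn-scaled {i} {j} j∈ f with scale-to-1 {f = f₀} {x = V i} [] (f₀≢0 i)
    ... | f₁ , s = begin
        σ f₀ i ℤ.* σ f j                          ≡⟨ cong (λ t → σ f₀ i ℤ.* t) (scaled f) ⟩
        σ f₀ i ℤ.* (σ f i ℤ.* σ f₁ j)
          ≡⟨ solve 3 (λ x y z → x :* (y :* z) := y :* (x :* z)) refl (σ f₀ i) (σ f i) (σ f₁ j) ⟩
        σ f i ℤ.* (σ f₀ i ℤ.* σ f₁ j)             ≡⟨ cong (λ t → σ f i ℤ.* t) (scaled f₀) ⟨
        σ f i ℤ.* σ f₀ j                          ∎
      where
      open +-*-Solver
      scaled : ∀ f → σ f j ≡ σ f i ℤ.* σ f₁ j
      scaled f = trans (cong sgn (on-line s [] j∈)) (sgn-* _ _)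

    σ₀-unit : ∀ i → σ f₀ i ≡ 1ℤ ⊎ σ f₀ i ≡ -1ℤ
    σ₀-unit i with σ f₀ i | hasSign (f₀ · V i)
    ... | _ | pos _ = inj₁ refl
    ... | _ | null e = ⊥-elim (f₀≢0 i e)
    ... | _ | neg _ = inj₂ refl

    antipodal-σ : ∀ {i j} → Antipodal i j → ∀ f → σ f j ≡ ℤ.- σ f i
    antipodal-σ {i} {j} (j∈ , e) f with σ₀-unit i | sgn-scaled j∈ f
    ... | inj₁ p | eq rewrite e | p = trans (sym (ℤ.*-identityˡ _)) (trans eq (trans (ℤ.*-comm (σ f i) -1ℤ) (ℤ.-1*i≡-i _)))
    ... | inj₂ p | eq rewrite e | p = ℤ.neg-injective
          (trans (sym (ℤ.-1*i≡-i _)) (trans eq (trans (ℤ.*-identityʳ _) (sym (ℤ.neg-involutive _)))))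

    antipodal-≢ : ∀ {i j} → Antipodal i j → ¬ i ≡ j
    antipodal-≢ {i} (_ , e) refl with σ f₀ i | σ₀-unit i
    antipodal-≢ (_ , ()) refl | _ | inj₁ refl
    antipodal-≢ (_ , ()) refl | _ | inj₂ refl

    closed-pair≥1 : ∀ {i j} → Antipodal i j → ∀ f → 1ℤ ℤ.≤ closed f i ℤ.+ closed f j
    closed-pair≥1 {i} {j} anti f with σ f i | closed f i | closedSign f i | σ f j | closed f j | closedSign f j | antipodal-σ anti f
    ... | _ | _ | pos _  | _ | _ | neg _  | _ = ℤ.≤-refl
    ... | _ | _ | null _ | _ | _ | null _ | _ = ℤ.+≤+ (ℕ.s≤s ℕ.z≤n)
    ... | _ | _ | neg _  | _ | _ | pos _  | _ = ℤ.≤-refl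
    ... | _ | _ | neg _  | _ | _ | neg _ | ()
    ... | _ | _ | neg _  | _ | _ | null _ | ()

    closed-pair≡1 : ∀ {i j} → Antipodal i j → ∀ {f} → NowhereZero f → closed f i ℤ.+ closed f j ≡ 1ℤ
    closed-pair≡1 {i} {j} anti {f} nz with σ f i | closed f i | closedSign f i | σ f j | closed f j | closedSign f j | antipodal-σ anti f
    ... | _ | _ | pos _  | _ | _ | neg _  | _ = refl
    ... | _ | _ | null e | _ | _ | _ | _ = ⊥-elim (nz i e)
    ... | _ | _ | neg _  | _ | _ | pos _  | _ = refl
    ... | _ | _ | neg _  | _ | _ | neg _ | ()
    ... | _ | _ | neg _  | _ | _ | null _ | ()

    -- Label zero marks what is left after removing `k` pairs. `closed-split` asks for a functional
    -- without zeros, since a pair inside the hyperplane counts twice in the closed side; `spanning`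
    -- takes one vector per pair.
    record PairDecomposition (k : ℕ) : Set where
      field
        lab : Fin n → Fin (suc k)
        pairs : ∀ l → ∃ λ i → ∃ λ j → Antipodal i j × (∀ x → part V lab (suc l) x ≡ pair i j x)
        spanning : ∃ λ ys → length ys ≡ k × (∀ x → part V lab zero x ≡ false → V x ∈cl ys)
        same-dsc : ∀ f → dsc whole f ≡ dsc (part V lab zero) f
        closed-split : ∀ {f} → NowhereZero f → Σ⟨ whole ⟩ (closed f) ≡ ℤ.+ k ℤ.+ Σ⟨ part V lab zero ⟩ (closed f)

      rest : Subfamily n
      rest = part V lab zero

    trivial : PairDecomposition 0
    trivial = record
      { lab = λ _ → zero ; pairs = λ () ; spanning = [] , refl , λ _ () ; same-dsc = λ _ → refl
      ; closed-split = λ _ → sym (ℤ.+-identityˡ _) }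

    extend : ∀ {k} (P : PairDecomposition k) {i j} →
      PairDecomposition.rest P i ≡ true → PairDecomposition.rest P j ≡ true → Antipodal i j →
      ∃ λ (Q : PairDecomposition (suc k)) → count (PairDecomposition.rest Q) ℕ.< count (PairDecomposition.rest P)
    extend {k} P {i} {j} Ri Rj anti = record
      { lab = lab′
      ; pairs = λ { zero → i , j , anti , part-1
                  ; (suc l) → let (i′ , j′ , anti′ , e) = pairs l in i′ , j′ , anti′ , λ x → trans (part-2+ l x) (e x) }
      ; spanning = V i ∷ proj₁ spanning , cong suc (proj₁ (proj₂ spanning)) , span
      ; same-dsc = λ f → trans (same-dsc f) (trans (sum-remove-pair {rest} Ri Rj i≢j (σ f))
          (trans (cong₂ ℤ._+_ (trans (cong (λ t → σ f i ℤ.+ t) (antipodal-σ anti f)) (ℤ.+-inverseʳ (σ f i)))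
                              (Σ⟨⟩-cong {t = σ f} (λ x → sym (part-0 x)) λ _ _ → refl)) (ℤ.+-identityˡ _)))
      ; closed-split = λ {f} nz → trans (closed-split nz) (trans
          (cong (λ t → ℤ.+ k ℤ.+ t) (trans (sum-remove-pair {rest} Ri Rj i≢j (closed f))
          (cong₂ ℤ._+_ (closed-pair≡1 anti nz) (Σ⟨⟩-cong {t = closed f} (λ x → sym (part-0 x)) λ _ _ → refl))))
          (solve 2 (λ k c → k :+ (con 1ℤ :+ c) := con 1ℤ :+ k :+ c) refl (ℤ.+ k) (Σ⟨ part V lab′ zero ⟩ (closed f))))
      } , count-< {p = part V lab′ zero} (λ x e → ∧⁻ˡ (trans (sym (part-0 x)) e)) i Ri (trans (part-0 i) gone)
      where
      open PairDecomposition P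
      open +-*-Solver
      i≢j = antipodal-≢ anti
      -- The new pair receives label one; older pairs move up, and zero stays with the rest.
      shift : Fin (suc k) → Fin (suc (suc k))
      shift zero = zero
      shift (suc l) = suc (suc l)
      lab′ : Fin n → Fin (suc (suc k))
      lab′ x = if pair i j x then suc zero else shift (lab x)
      gone : rest i ∧ not (pair i j i) ≡ false
      gone rewrite dec-true (i Fin.≟ i) refl = Bool.∧-zeroʳ (rest i)
      part-0 : ∀ x → part V lab′ zero x ≡ (rest ∖pair i , j) x
      part-0 x with pair i j x
      ... | true = sym (Bool.∧-zeroʳ (rest x))
      ... | false with lab x
      ... | zero = refl
      ... | suc l = refl
      part-1 : ∀ x → part V lab′ (suc zero) x ≡ pair i j x
      part-1 x with pair i j x
      ... | true = refl
      ... | false with lab x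
      ... | zero = refl
      ... | suc l = refl
      pair⊆rest : ∀ x → pair i j x ≡ true → rest x ≡ true
      pair⊆rest x e with x Fin.≟ i | x Fin.≟ j
      ... | yes refl | _ = Ri
      ... | no _ | yes refl = Rj
      part-2+ : ∀ l x → part V lab′ (suc (suc l)) x ≡ part V lab (suc l) x
      part-2+ l x with pair i j x | pair⊆rest x
      ... | true | r = sym (lab-0 (r refl))
        where
        lab-0 : part V lab zero x ≡ true → part V lab (suc l) x ≡ false
        lab-0 e with lab x
        ... | zero = refl
      ... | false | _ with lab x
      ... | zero = refl
      ... | suc _ = refl
      span : ∀ x → part V lab′ zero x ≡ false → V x ∈cl (V i ∷ proj₁ spanning)
      span x e with rest x in eq | trans (sym (part-0 x)) e
      ... | false | _ = ∈cl-there (proj₂ (proj₂ spanning) x eq)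
      ... | true | e′ with x Fin.≟ i | x Fin.≟ j
      ... | yes refl | _ = ∈cl-head
      ... | no _ | yes refl = λ { f (fi ∷ _) → proj₁ anti f (fi ∷ []) }

    PairFree : Subfamily n → Set
    PairFree S = ∀ i j → S i ≡ true → S j ≡ true → ¬ Antipodal i j

    abstract
      maximal : ∃ λ k → ∃ λ (P : PairDecomposition k) → PairFree (PairDecomposition.rest P)
      maximal = go (suc (count (PairDecomposition.rest trivial))) trivial ℕ.≤-refl
        where
        go : ∀ m {k} (P : PairDecomposition k) → count (PairDecomposition.rest P) ℕ.< m →
          ∃ λ k → ∃ λ (P : PairDecomposition k) → PairFree (PairDecomposition.rest P)
        go (suc m) {k} P (ℕ.s≤s lt) with Fin.any? (λ i → Fin.any? λ j →
            (PairDecomposition.rest P i Bool.≟ true) ×-dec (PairDecomposition.rest P j Bool.≟ true) ×-dec antipodal? i j)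
        ... | no none = k , P , λ i j Ri Rj anti → none (i , j , Ri , Rj , anti)
        ... | yes (i , j , Ri , Rj , anti) = let (Q , fewer) = extend P Ri Rj anti in go m Q (ℕ.<-≤-trans fewer lt)

    -- Without antipodal pairs all vectors on the line of `x` have the same sign under `f₀`, so its
    -- discrepancy is, up to sign, its positive number of vectors.
    pairFree⇒reduced : ∀ {S} → PairFree S → Reduced [] S
    pairFree⇒reduced {S} free x Sx bal with ℤ.i*j≡0⇒i≡0∨j≡0 (σ f₀ x) (trans (sym total) (bal f₀ []))
      where
      L = S ∩cl (V x ∷ [])
      same-sign : ∀ j → L j ≡ true → σ f₀ j ≡ σ f₀ x ℤ.* 1ℤ
      same-sign j Lj = trans (agree (σ₀-unit x) (σ₀-unit j)) (sym (ℤ.*-identityʳ _))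
        where
        ¬opp : ¬ σ f₀ j ≡ ℤ.- σ f₀ x
        ¬opp e = free x j Sx (∩cl⁻ˡ {S} {V x ∷ []} Lj) (∩cl⁻ʳ {S} {V x ∷ []} Lj , e)
        agree : σ f₀ x ≡ 1ℤ ⊎ σ f₀ x ≡ -1ℤ → σ f₀ j ≡ 1ℤ ⊎ σ f₀ j ≡ -1ℤ → σ f₀ j ≡ σ f₀ x
        agree (inj₁ p) (inj₁ q) = trans q (sym p)
        agree (inj₂ p) (inj₂ q) = trans q (sym p)
        agree (inj₁ p) (inj₂ q) = ⊥-elim (¬opp (trans q (cong ℤ.-_ (sym p))))
        agree (inj₂ p) (inj₁ q) = ⊥-elim (¬opp (trans q (cong ℤ.-_ (sym p))))
      restrict-* : ∀ j → restrict L (λ _ → σ f₀ x ℤ.* 1ℤ) j ≡ σ f₀ x ℤ.* restrict L (λ _ → 1ℤ) j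
      restrict-* j with L j
      ... | true = refl
      ... | false = sym (ℤ.*-zeroʳ (σ f₀ x))
      total : dsc L f₀ ≡ σ f₀ x ℤ.* ℤ.+ count L
      total = begin
        dsc L f₀
          ≡⟨ Σ⟨⟩-cong {L} {L} {σ f₀} {λ _ → σ f₀ x ℤ.* 1ℤ} (λ _ → refl) same-sign ⟩
        Σ⟨ L ⟩ (λ _ → σ f₀ x ℤ.* 1ℤ)                  ≡⟨ sum-cong-≗ restrict-* ⟩
        sum (λ j → σ f₀ x ℤ.* restrict L (λ _ → 1ℤ) j) ≡⟨ *-distribˡ-sum (σ f₀ x) (restrict L (λ _ → 1ℤ)) ⟨
        σ f₀ x ℤ.* sum (restrict L (λ _ → 1ℤ))        ≡⟨ cong (λ t → σ f₀ x ℤ.* t) (count-sum L) ⟨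
        σ f₀ x ℤ.* ℤ.+ count L                        ∎
    ... | inj₁ z = f₀≢0 x (sgn≡0⇒≡0 z)
    ... | inj₂ z = ℕ.<⇒≢ (ℕ.≤-<-trans ℕ.z≤n
          (count-< {p = λ _ → false} (λ _ ()) x (∩cl⁺ {S} {V x ∷ []} Sx ∈cl-head) refl)) (sym (ℤ.+-injective z))

-- Construction of the codegree* decomposition.

module Decomposition (F : OrderedField) {a n : ℕ} (V : Geometry.Config F a n) where
  open OrderedField F
  open Geometry F
  open AntipodalPairs F V
  open SpanningBound F V
  open Dimension F {n}

  zero-· : ∀ {f : Vector a} → IsZero f → ∀ v → f · v ≡ 0#
  zero-· z v = Σ-zero λ i → trans (cong (_* v i) (z i)) (zeroˡ (v i))

  nowhereZero⇒nonzero : Fin n → ∀ {f} → NowhereZero f → ¬ IsZero f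
  nowhereZero⇒nonzero j nz z = nz j (zero-· z (V j))

  -- A replacement for `f` without zeros on `V` that is no worse for either extremal problem, so
  -- maxima of discrepancy and minima of closed counts may be sought among such functionals.
  record Generic (f : Vector a) : Set where
    field
      functional : Vector a
      nowhereZero : NowhereZero functional
      dsc-≤ : dsc whole f ℤ.≤ dsc whole functional
      closed-≤ : ∀ S → closedMinusCount V functional S ℕ.≤ closedMinusCount V f S

  module _ (irr : Irreducible V) where

    ∉cl[] : ∀ j → ¬ V j ∈cl []
    ∉cl[] j j∈ = irr j λ i → trans (sym (basis-· i (V j))) (j∈ (basis i) [])

    abstract
      genericPerturbation : ∀ f → Generic f
      -- With no generators the span is zero, so by irreducibility generic means nowhere zero.
      -- Strictly positive vectors stay positive, hence no closed count grows.
      genericPerturbation f with generic-perturbation {[]} {f} [] whole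
      ... | h , (_ , h≢0) , keep , le = record
        { functional = h
        ; nowhereZero = λ j → h≢0 j (∉cl[] j)
        ; dsc-≤ = le
        ; closed-≤ = λ S → count-≤ λ j e → cong₂ _∧_ (∧⁻ˡ e) (not-pos j (∧⁻ʳ {S j} e))
        }
        where
        pos-kept : ∀ j → 0# < f · V j → 0# < h · V j
        pos-kept j 0<f with sgn (h · V j) | hasSign (h · V j) | trans (keep j (λ z → <-irrefl (sym z) 0<f)) (sgn-pos 0<f)
        ... | _ | pos p | _ = p
        not-pos : ∀ j → not (pos? V h j) ≡ true → not (pos? V f j) ≡ true
        not-pos j e with 0# <? (f · V j)
        ... | no _ = refl
        ... | yes 0<f with () ← trans (sym e) (cong not (dec-true (0# <? (h · V j)) (pos-kept j 0<f)))

    module WithMaximum {p : ℕ} (maxPlus : IsMaxPlus V p) (j₀ : Fin n) where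

      private
        fₚ = proj₁ (proj₁ (proj₁ maxPlus))
        module G = Generic (genericPerturbation fₚ)

      -- A nowhere zero functional with maximal positive side. It also attains the codegree* of `V`,
      -- of every pair and of the rest, and the discrepancy of `V`. The index `j₀` serves to show
      -- that it is not the zero functional.
      f* : Vector a
      f* = G.functional

      f*≢0 : NowhereZero f*
      f*≢0 = G.nowhereZero

      f*-functional : Functional a
      f*-functional = f* , nowhereZero⇒nonzero j₀ f*≢0

      κ : ℕ
      κ = closedMinusCount V f* whole

      private
        closed-fₚ-≤ : ∀ ((f , _) : Functional a) → closedMinusCount V fₚ whole ℕ.≤ closedMinusCount V f whole
        closed-fₚ-≤ F@(f , _) = ℕ.+-cancelˡ-≤ p _ _ (ℕ.≤-trans (ℕ.≤-reflexive p+closed)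
            (ℕ.≤-trans (ℕ.≤-reflexive (sym (plus+closed f))) (ℕ.+-monoˡ-≤ _ (proj₂ maxPlus F))))
          where
          p+closed : p ℕ.+ closedMinusCount V fₚ whole ≡ n
          p+closed = trans (cong (ℕ._+ closedMinusCount V fₚ whole) (sym (proj₂ (proj₁ maxPlus)))) (plus+closed fₚ)

      κ-codegree : IsCodegStar V whole κ
      κ-codegree = (f*-functional , refl) , λ F → ℕ.≤-trans (G.closed-≤ whole) (closed-fₚ-≤ F)

      p+κ≡n : p ℕ.+ κ ≡ n
      p+κ≡n = trans (cong₂ ℕ._+_ (sym (proj₂ (proj₁ maxPlus)))
        (ℕ.≤-antisym (G.closed-≤ whole) (closed-fₚ-≤ f*-functional))) (plus+closed fₚ)

      module WithDiscrepancy {D : ℤ} (isDisc : IsDisc V D) where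

        -- Among nowhere zero functionals, `dsc+2closed` makes the largest discrepancy occur at the
        -- smallest closed count, thus at `f*`; a maximiser of the discrepancy may be taken nowhere
        -- zero.
        D+2κ≡n : D ℤ.+ (ℤ.+ κ ℤ.+ ℤ.+ κ) ≡ ℤ.+ n
        D+2κ≡n = trans (cong (ℤ._+ (ℤ.+ κ ℤ.+ ℤ.+ κ)) D≡dsc) (trans (dsc+2closed f*≢0 whole) (cong ℤ.+_ count-whole))
          where
          fD = proj₁ (proj₁ (proj₁ isDisc))
          module H = Generic (genericPerturbation fD)
          h = H.functional
          κₕ = closedMinusCount V h whole
          κ≤κₕ : κ ℕ.≤ κₕ
          κ≤κₕ = proj₂ κ-codegree (h , nowhereZero⇒nonzero j₀ H.nowhereZero)
          dsc-h≤ : dsc whole h ℤ.≤ dsc whole f*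
          dsc-h≤ = ℤ.≮⇒≥ λ lt → ℤ.<-irrefl (trans (dsc+2closed f*≢0 whole) (sym (dsc+2closed H.nowhereZero whole)))
            (ℤ.+-mono-<-≤ lt (ℤ.+≤+ (ℕ.+-mono-≤ κ≤κₕ κ≤κₕ)))
          D≡dsc : D ≡ dsc whole f*
          D≡dsc = ℤ.≤-antisym
            (ℤ.≤-trans (ℤ.≤-reflexive (trans (sym (proj₂ (proj₁ isDisc))) (disc-dsc fD))) (ℤ.≤-trans H.dsc-≤ dsc-h≤))
            (subst (ℤ._≤ D) (disc-dsc f*) (proj₂ isDisc f*-functional))

      module WithRank {D r : ℕ} (0<D : 0 ℕ.< D) (isDisc : IsDisc V (ℤ.+ D)) (rank : IsRank V r) where
        open Matching f* f*≢0

        k : ℕ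
        k = proj₁ maximal
        open PairDecomposition (proj₁ (proj₂ maximal))

        dsc-≤D : ∀ f → dsc rest f ℤ.≤ ℤ.+ D
        dsc-≤D f with Fin.all? (λ i → f i ≟ 0#)
        ... | no nz = subst (ℤ._≤ ℤ.+ D) (trans (disc-dsc f) (same-dsc f)) (proj₂ isDisc (f , nz))
        -- The discrepancy of `V` ranges over nonzero functionals; the zero functional has
        -- discrepancy 0.
        ... | yes z = ℤ.≤-trans (ℤ.≤-reflexive (dsc-vanishing {rest} λ j _ → zero-· z (V j))) (ℤ.+≤+ ℕ.z≤n)

        -- Each removed pair spans a line, so it adds at most one generator.
        r≤length+k : ∀ ys → (∀ x → rest x ≡ true → V x ∈cl ys) → r ℕ.≤ length ys ℕ.+ k
        r≤length+k ys ys-span with proj₁ rank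
        ... | S , ind , count≡r = ℕ.≤-trans (ℕ.≤-reflexive (sym count≡r)) (ℕ.≤-trans
            (independent⇒count≤length (ys ++ proj₁ spanning) V S ind λ x _ → all-span x)
            (ℕ.≤-reflexive (trans (List.length-++ ys) (cong (length ys ℕ.+_) (proj₁ (proj₂ spanning))))))
          where
          all-span : ∀ x → V x ∈cl (ys ++ proj₁ spanning)
          all-span x f f⟂ with rest x in eq
          ... | true = ys-span x eq f (All.++⁻ˡ ys f⟂)
          ... | false = proj₂ (proj₂ spanning) x eq f (All.++⁻ʳ ys f⟂)

        r≤2D+k : r ℕ.≤ 2 ℕ.* D ℕ.+ k
        r≤2D+k = decidable-stable (r ℕ.≤? 2 ℕ.* D ℕ.+ k) λ r≰ →
          bounded⇒spanned D [] rest (pairFree⇒reduced (proj₂ (proj₂ maximal))) (λ f _ → dsc-≤D f) λ (ys , len , span) →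
          r≰ (ℕ.≤-trans (r≤length+k ys λ x Rx f f⟂ → span x Rx f (All.++⁺ f⟂ [])) (ℕ.+-monoˡ-≤ k len))

        c : ℕ
        c = closedMinusCount V f* rest

        closed-split-ℕ : ∀ {f} → NowhereZero f → closedMinusCount V f whole ≡ k ℕ.+ closedMinusCount V f rest
        closed-split-ℕ {f} nz = ℤ.+-injective (trans (closedMinus-sum f whole) (trans (closed-split nz)
          (cong (λ t → ℤ.+ k ℤ.+ t) (sym (closedMinus-sum f rest)))))

        pair-codegree : ∀ l → IsCodegStar V (part V lab (suc l)) 1
        pair-codegree l with pairs l
        ... | i , j , anti , e = (f*-functional , ℤ.+-injective (trans (closed-pair f*) (closed-pair≡1 anti f*≢0))) ,
            λ (f , _) → ℤ.drop‿+≤+ (ℤ.≤-trans (closed-pair≥1 anti f) (ℤ.≤-reflexive (sym (closed-pair f))))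
          where
          closed-pair : ∀ f → ℤ.+ closedMinusCount V f (part V lab (suc l)) ≡ closed f i ℤ.+ closed f j
          closed-pair f = trans (closedMinus-sum f (part V lab (suc l)))
            (trans (Σ⟨⟩-cong {t = closed f} e λ _ _ → refl) (sum-pair (antipodal-≢ anti) (closed f)))

        -- For nowhere zero functionals the closed counts of `V` and of the rest differ by the
        -- constant `k`, so `f*` minimises both; any other functional is compared through its
        -- generic replacement.
        rest-codegree : IsCodegStar V rest c
        rest-codegree = (f*-functional , refl) , λ (f , _) →
          let module H = Generic (genericPerturbation f) in
          ℕ.≤-trans (ℕ.+-cancelˡ-≤ k _ _ (ℕ.≤-trans (ℕ.≤-reflexive (sym (closed-split-ℕ f*≢0)))
              (ℕ.≤-trans (proj₂ κ-codegree (H.functional , nowhereZero⇒nonzero j₀ H.nowhereZero))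
                         (ℕ.≤-reflexive (closed-split-ℕ H.nowhereZero)))))
            (H.closed-≤ rest)

        sumℕ-1 : ∀ m → sumℕ {m} (λ _ → 1) ≡ m
        sumℕ-1 zero = refl
        sumℕ-1 (suc m) = cong suc (sumℕ-1 m)

        decomposition : ∃ λ m → CodegDecomposition V m × suc r ℕ.≤ 2 ℕ.* D ℕ.+ m
        decomposition = by-codegree c refl
          where
          by-codegree : ∀ c′ → c ≡ c′ → ∃ λ m → CodegDecomposition V m × suc r ℕ.≤ 2 ℕ.* D ℕ.+ m
          -- The rest lies on the positive side of `f*` and stays in the part with label zero. All
          -- its vectors then count positively, so it has at most `D` of them; hence `r` is at most
          -- `D + k`, and positivity of `D` gains the missing one.
          by-codegree zero c≡ = k , (lab , (λ _ → 1) , pair-codegree , (λ _ → ℕ.≤-refl) , subst (IsCodegStar V whole) κ≡ κ-codegree) , bound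
            where
            κ≡ : κ ≡ sumℕ {k} (λ _ → 1)
            κ≡ = trans (closed-split-ℕ f*≢0) (trans (cong (k ℕ.+_) c≡) (trans (ℕ.+-identityʳ k) (sym (sumℕ-1 k))))
            count≤D : count rest ℕ.≤ D
            count≤D = ℤ.drop‿+≤+ (ℤ.≤-trans (ℤ.≤-reflexive (trans (sym (dsc+2closed f*≢0 rest))
              (trans (cong (λ t → dsc rest f* ℤ.+ (ℤ.+ t ℤ.+ ℤ.+ t)) c≡) (ℤ.+-identityʳ _)))) (dsc-≤D f*))
            bound : suc r ℕ.≤ 2 ℕ.* D ℕ.+ k
            bound with listing V rest
            ... | ws , len , ws-span = ℕ.≤-trans (ℕ.s≤s (ℕ.≤-trans (r≤length+k ws ws-span)
                (ℕ.+-monoˡ-≤ k (ℕ.≤-trans (ℕ.≤-reflexive len) count≤D))))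
              (ℕ.+-monoˡ-≤ k (ℕ.≤-trans (ℕ.+-monoˡ-≤ D 0<D) (ℕ.+-monoʳ-≤ D (ℕ.≤-reflexive (sym (ℕ.+-identityʳ D))))))
          -- The rest has positive codegree* and becomes a part of its own: raising all labels by
          -- one leaves the part with label zero empty.
          by-codegree (suc c-1) c≡ = suc k , (suc ∘ lab , cs , codegrees , positive , subst (IsCodegStar V whole) κ≡ κ-codegree) ,
              ℕ.≤-trans (ℕ.s≤s r≤2D+k) (ℕ.≤-reflexive (sym (ℕ.+-suc (2 ℕ.* D) k)))
            where
            cs : Fin (suc k) → ℕ
            cs zero = suc c-1
            cs (suc _) = 1
            codegrees : ∀ i → IsCodegStar V (part V (suc ∘ lab) (suc i)) (cs i)
            codegrees zero = subst (IsCodegStar V rest) c≡ rest-codegree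
            codegrees (suc l) = pair-codegree l
            positive : ∀ i → 1 ℕ.≤ cs i
            positive zero = ℕ.s≤s ℕ.z≤n
            positive (suc _) = ℕ.≤-refl
            κ≡ : κ ≡ sumℕ cs
            κ≡ = trans (closed-split-ℕ f*≢0) (trans (ℕ.+-comm k c) (cong₂ ℕ._+_ c≡ (sym (sumℕ-1 k))))

-- Integer identities and the final assembly.

open import Data.Integer using (+_; _+_; _-_; _*_; _≤_; _<_)

-- Every quantity is linear in the maximal positive count `p`, the codegree* `κ` and the rank `r`;
-- substitution leaves ring identities.
length-formulas : ∀ {n r p κ D δ} → n ≡ p + κ → D ≡ p - κ → δ ≡ p - r →
  (r + + 1 - + 2 * D ≡ + 2 * (n - r - + 1 + + 1 - + 2 * δ) - r + + 1) ×
  (r + + 1 - + 2 * D ≡ + 3 * (n - r - + 1) + + 4 - + 4 * δ - n)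
length-formulas {r = r} {p} {κ} refl refl refl =
  solve 3 (λ p κ r → r :+ con (+ 1) :- con (+ 2) :* (p :- κ) :=
    con (+ 2) :* (p :+ κ :- r :- con (+ 1) :+ con (+ 1) :- con (+ 2) :* (p :- r)) :- r :+ con (+ 1)) refl p κ r ,
  solve 3 (λ p κ r → r :+ con (+ 1) :- con (+ 2) :* (p :- κ) :=
    con (+ 3) :* (p :+ κ :- r :- con (+ 1)) :+ con (+ 4) :- con (+ 4) :* (p :- r) :- (p :+ κ)) refl p κ r
  where open +-*-Solver

solve-for-D : ∀ {D} p κ → D + (κ + κ) ≡ p + κ → D ≡ p - κ
solve-for-D {D} p κ e = begin
  D                              ≡⟨ solve 2 (λ D κ → D := (D :+ (κ :+ κ)) :- (κ :+ κ)) refl D κ ⟩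
  (D + (κ + κ)) - (κ + κ)        ≡⟨ cong (_- (κ + κ)) e ⟩
  (p + κ) - (κ + κ)              ≡⟨ solve 2 (λ p κ → (p :+ κ) :- (κ :+ κ) := p :- κ) refl p κ ⟩
  p - κ                          ∎
  where open +-*-Solver

mainTheorem2 : (F : OrderedField) → let open Geometry F in
    ∀ {a n : ℕ} (V : Config a n) (r : ℕ) (D δ : ℤ) →
    Irreducible V → IsRank V r → IsDisc V D → IsDegStar V δ → + 0 < D →
    let d : ℤ
        d = + n - + r - + 1
    in (((+ r + + 1 - + 2 * D) ≡ (+ 2 * (d + + 1 - + 2 * δ) - + r + + 1)) ×
        ((+ r + + 1 - + 2 * D) ≡ (+ 3 * d + + 4 - + 4 * δ - + n))) ×
       Σ ℕ (λ m → CodegDecomposition V m × (+ r + + 1 - + 2 * D) ≤ + m)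
-- An empty configuration has discrepancy 0, contrary to `0<D`.
mainTheorem2 F {n = zero} V r D δ irr rank isDisc deg 0<D = ⊥-elim (ℤ.<-irrefl (proj₂ (proj₁ isDisc)) 0<D)
mainTheorem2 F {n = n@(suc _)} V r (+ D) δ irr rank isDisc (p , r′ , maxPlus , rank′ , δ≡) (ℤ.+<+ 0<D) =
  length-formulas {r = + r} {+ p} {+ κ} n≡p+κ D≡p-κ δ≡p-r ,
  proj₁ decomposition , proj₁ (proj₂ decomposition) , length-bound (proj₂ (proj₂ decomposition))
  where
  open Geometry F
  open Decomposition F V
  module M = WithMaximum irr maxPlus zero
  open M using (κ)
  open M.WithRank 0<D isDisc rank using (decomposition)
  open +-*-Solver

  -- The dual degree carries its own witness of the rank, which has to be identified with the given
  -- one.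
  r′≡r : r′ ≡ r
  r′≡r = ℕ.≤-antisym (≤-of rank′ rank) (≤-of rank rank′)
    where
    ≤-of : ∀ {s t} → IsRank V s → IsRank V t → s ℕ.≤ t
    ≤-of ((S , ind , refl) , _) (_ , ub) = ub S ind

  δ≡p-r : δ ≡ + p - + r
  δ≡p-r = trans δ≡ (cong (λ t → + p - + t) r′≡r)

  n≡p+κ : + n ≡ + p + + κ
  n≡p+κ = cong +_ (sym M.p+κ≡n)

  D≡p-κ : + D ≡ + p - + κ
  D≡p-κ = solve-for-D (+ p) (+ κ) (trans (M.WithDiscrepancy.D+2κ≡n isDisc) n≡p+κ)

  length-bound : ∀ {m} → suc r ℕ.≤ 2 ℕ.* D ℕ.+ m → + r + + 1 - + 2 * + D ≤ + m
  length-bound {m} le = ℤ.≤-trans (ℤ.+-monoˡ-≤ (ℤ.- (+ 2 * + D)) (ℤ.≤-trans (ℤ.≤-reflexive (ℤ.+-comm (+ r) (+ 1))) (ℤ.+≤+ le)))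
    (ℤ.≤-reflexive (trans (cong (λ t → t + + m - + 2 * + D) (ℤ.pos-* 2 D))
      (solve 2 (λ D m → con (+ 2) :* D :+ m :- con (+ 2) :* D := m) refl (+ D) (+ m))))
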